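{- Let $G=(V,E)$ be a connected graph and let $\widehat G=(V,E\cup F)$ with $F\subseteq\binom{V}{2}\setminus E$. (a) For any cycle $C=(V_C,E_C)$ in $G$ and any $f\in E_C$, the inequality $x_f\le\sum_{e\in E_C\setminus\{f\}}x_e$ defines a facet of $\mathrm{LMC}(G,\widehat G)$ if and only if $C$ is chordless in $\widehat G$. (b) For any $f=uv\in F$ and any $uv$-path $P=(V_P,E_P)$ in $G$, the inequality $x_{uv}\le\sum_{e\in E_P}x_e$ defines a facet of $\mathrm{LMC}(G,\widehat G)$ if and only if $E_P\cup\{f\}$ induces a chordless cycle in $\widehat G$.
   Context: Graphs are finite, simple, undirected; $uv$ denotes $\{u,v\}$. A cycle is chordless in $\widehat G$ if no edge of $E\cup F$ joins two nodes of the cycle that are not consecutive on it. A decomposition of $G$ is a partition $\Pi$ of $V$ such that each block induces a connected subgraph of $G$; the multicut of $\widehat G$ lifted from $G$ induced by $\Pi$ is the set of edges of $E\cup F$ whose endpoints lie in distinct blocks of $\Pi$. $\mathrm{LMC}(G,\widehat G)\subseteq\mathbb{R}^{E\cup F}$ is the convex hull of the characteristic vectors of all multicuts of $\widehat G$ lifted from $G$. -}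

module Defs where

open import Data.Nat using (ℕ; zero; suc; _≤ᵇ_) renaming (_≤_ to _≤ℕ_)
open import Data.Nat.DivMod using (_%_; m%n<n)
open import Data.Fin using (Fin; zero; suc; toℕ; fromℕ<; fromℕ; inject₁; _≟_)
open import Data.Bool using (Bool; true; false; _∨_; not; if_then_else_)
open import Data.Rational using (ℚ; 0ℚ; 1ℚ; _+_; _*_; _≤_)
open import Data.Product using (Σ; _×_)
open import Data.Unit using (⊤)
open import Relation.Nullary using (¬_)
open import Relation.Nullary.Decidable using (⌊_⌋)
open import Relation.Binary.PropositionalEquality using (_≡_; _≢_)

Graph : ℕ → Set
Graph n = Fin n → Fin n → Bool

SimpleGraph : ∀ {n} → Graph n → Set
SimpleGraph E = (∀ i j → E i j ≡ E j i) × (∀ i → E i i ≡ false)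

Disjoint : ∀ {n} → Graph n → Graph n → Set
Disjoint E F = ∀ i j → E i j ≡ true → F i j ≡ false

_∪G_ : ∀ {n} → Graph n → Graph n → Graph n
(E ∪G F) i j = E i j ∨ F i j

data Reach {n} (E : Graph n) (S : Fin n → Set) : Fin n → Fin n → Set where
  here : ∀ {i} → S i → Reach E S i i
  step : ∀ {i j k} → S i → E i j ≡ true → Reach E S j k → Reach E S i k

Connected : ∀ {n} → Graph n → Set
Connected E = ∀ i j → Reach E (λ _ → ⊤) i j

-- A partition of V is represented by a block labelling (blocks = fibres).
Labelling : ℕ → Set
Labelling n = Fin n → Fin n

IsDecomposition : ∀ {n} → Graph n → Labelling n → Set
IsDecomposition E ℓ = ∀ i j → ℓ i ≡ ℓ j → Reach E (λ k → ℓ k ≡ ℓ i) i j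

-- Points of ℚ^{V×V}; a point x restricted to edges uv of Ĝ gives x_{uv} = x u v.
Point : ℕ → Set
Point n = Fin n → Fin n → ℚ

-- characteristic vector of the multicut of Ĝ induced by ℓ (zero off Ĝ, symmetric)
χ : ∀ {n} → Graph n → Labelling n → Point n
χ Ĝ ℓ i j = if Ĝ i j then (if ⌊ ℓ i ≟ ℓ j ⌋ then 0ℚ else 1ℚ) else 0ℚ

∑ : ∀ {k} → (Fin k → ℚ) → ℚ
∑ {zero} f = 0ℚ
∑ {suc k} f = f zero + ∑ (λ t → f (suc t))

AffIndep : ∀ {n k} → (Fin k → Point n) → Set
AffIndep {n} {k} p =
  (λ' : Fin k → ℚ) → ∑ λ' ≡ 0ℚ →
  (∀ i j → ∑ (λ t → λ' t * p t i j) ≡ 0ℚ) → ∀ t → λ' t ≡ 0ℚ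

HasAffIndep : ∀ {n} → Graph n → (Labelling n → Set) → ℕ → Set
HasAffIndep {n} Ĝ S k =
  Σ (Fin k → Labelling n) λ ls → (∀ t → S (ls t)) × AffIndep (λ t → χ Ĝ (ls t))

-- conv of the vectors of S has (affine) dimension d
AffDim : ∀ {n} → Graph n → (Labelling n → Set) → ℕ → Set
AffDim Ĝ S d = HasAffIndep Ĝ S (suc d) × ¬ HasAffIndep Ĝ S (suc (suc d))

-- the inequality lhs(x) ≤ rhs(x) (lhs, rhs linear) defines a facet of LMC(G, Ĝ):
-- it is valid for all vertices and its face has dimension dim LMC − 1.
DefinesFacet : ∀ {n} → Graph n → Graph n → (Point n → ℚ) → (Point n → ℚ) → Set
DefinesFacet E Ĝ lhs rhs =
  (∀ ℓ → IsDecomposition E ℓ → lhs (χ Ĝ ℓ) ≤ rhs (χ Ĝ ℓ)) ×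
  Σ ℕ λ d →
    AffDim Ĝ (λ ℓ → IsDecomposition E ℓ × (lhs (χ Ĝ ℓ) ≡ rhs (χ Ĝ ℓ))) d ×
    AffDim Ĝ (IsDecomposition E) (suc d)

cnext : ∀ {m} → Fin m → Fin m
cnext {suc m} i = fromℕ< (m%n<n (suc (toℕ i)) (suc m))

InjectiveF : ∀ {m n} → (Fin m → Fin n) → Set
InjectiveF c = ∀ i j → c i ≡ c j → i ≡ j

IsCycle : ∀ {n m} → Graph n → (Fin m → Fin n) → Set
IsCycle {n} {m} H c = (3 ≤ℕ m) × InjectiveF c × (∀ k → H (c k) (c (cnext k)) ≡ true)

Chordless : ∀ {n m} → Graph n → (Fin m → Fin n) → Set
Chordless H c = ∀ i j → i ≢ j → j ≢ cnext i → i ≢ cnext j → H (c i) (c j) ≡ false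

IsPath : ∀ {n m} → Graph n → Fin n → Fin n → (Fin (suc m) → Fin n) → Set
IsPath {n} {m} E u v w =
  InjectiveF w × (w zero ≡ u) × (w (fromℕ m) ≡ v) ×
  (∀ (k : Fin m) → E (w (inject₁ k)) (w (suc k)) ≡ true)

-- Σ_{e ∈ E_C \ {f}} x_e, where f is the edge c f – c (f+1)
cycSumExcept : ∀ {n m} → (Fin m → Fin n) → Fin m → Point n → ℚ
cycSumExcept c f x = ∑ (λ k → if ⌊ k ≟ f ⌋ then 0ℚ else x (c k) (c (cnext k)))

pathSum : ∀ {n m} → (Fin (suc m) → Fin n) → Point n → ℚ
pathSum {n} {m} w x = ∑ {m} (λ k → x (w (inject₁ k)) (w (suc k)))

{-# OPTIONS --safe #-}

-- Write p 0, …, p r for the path of G obtained from the cycle by deleting f, and measure everything on the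
-- homogenised points (1, χ).  If the cycle has a chord, the inequality is the sum of the path inequalities of
-- the two shorter cycles, so two independent equations hold on the face.  If it is chordless, let q be the
-- partition cutting the path around p 1 (it is off the face): every unit vector of an edge of Ĝ lies in the span of
-- the face and q.  Indeed, if a decomposition is coarser than another and joins, besides uv, only edges already
-- treated, then the difference yields uv.  This treats in turn the edges of the cycle, the ancestor pairs of a
-- spanning forest rooted at the path, the edges between the path and the rest, and all remaining edges.

module Submission where

open import Defs
open import Data.Bool using (true; false; if_then_else_; _∨_)
import Data.Bool.Properties as Bool
open import Data.Fin using (Fin; zero; suc; toℕ; fromℕ<; inject₁; punchIn; punchOut; combine; remQuot; _≟_)
import Data.Fin.Properties as Fin
open import Data.Maybe using (Maybe; just; nothing)
open import Data.Nat as ℕ using (ℕ; zero; suc; z≤n; s≤s)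
open import Data.Nat.DivMod using (_%_; m%n<n; m<n⇒m%n≡m; m%n%n≡m%n; [m+n]%n≡m%n; %-distribˡ-+)
open import Data.Nat.Induction using (<-wellFounded)
import Data.Nat.Properties as ℕ
open import Data.Product using (Σ; _×_; _,_; proj₁; proj₂; ∃; uncurry)
open import Data.Rational using (ℚ; 0ℚ; 1ℚ; ½; _+_; _*_; _-_; -_; 1/_; _≤_; _≤?_; ≢-nonZero)
import Data.Rational.Properties as ℚ
open import Data.Rational.Solver using (module +-*-Solver)
open import Data.Sum using (_⊎_; inj₁; inj₂)
open import Data.Unit using (⊤)
open import Data.Vec.Functional using (_∷_)
open import Function using (_∘_; case_of_)
open import Function.Bundles using (_⇔_; mk⇔; Equivalence)
open import Induction.WellFounded using (Acc; acc)
open import Relation.Binary.Definitions using (tri<; tri≈; tri>)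
open import Relation.Binary.PropositionalEquality
open import Relation.Nullary using (¬_; Dec; yes; no; contradiction; _×-dec_; _⊎-dec_)
open import Relation.Nullary.Decidable using (⌊_⌋; from-yes; map′)

-- Linear algebra over ℚ

-- A decomposition on the face cuts either no path edge, or exactly one and then also separates the
-- two end nodes. On these the left side minus the right side is 0, whereas on the unit vector of a
-- path edge it is -1: the face alone cannot span that vector. The partition `q` has value `1 - 2`
-- and supplies the missing direction. The obstacle is connectedness of blocks. A node off the path
-- cannot join it alone but brings the branch that links it to the path, and refining a block cuts
-- all edges between its parts at once. The order of treatment is such that each comparison newly
-- cuts only one edge whose vector is not yet spanned. With a chord, the second equation comes from
-- the fact that a tight path admits no shortcut; partitions that isolate a single inner node of the
-- path show that the two equations are independent.

∑-cong : ∀ {k} {f g : Fin k → ℚ} → (∀ t → f t ≡ g t) → ∑ f ≡ ∑ g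
∑-cong {zero}  f≗g = refl
∑-cong {suc k} f≗g = cong₂ _+_ (f≗g zero) (∑-cong (f≗g ∘ suc))

∑-zero : ∀ {k} {f : Fin k → ℚ} → (∀ t → f t ≡ 0ℚ) → ∑ f ≡ 0ℚ
∑-zero {zero}  f≗0 = refl
∑-zero {suc k} f≗0 = trans (cong₂ _+_ (f≗0 zero) (∑-zero (f≗0 ∘ suc))) (ℚ.+-identityˡ 0ℚ)

∑-linear : ∀ {k} a b (f g : Fin k → ℚ) → ∑ (λ t → a * f t + b * g t) ≡ a * ∑ f + b * ∑ g
∑-linear {zero}  a b f g = sym (trans (cong₂ _+_ (ℚ.*-zeroʳ a) (ℚ.*-zeroʳ b)) (ℚ.+-identityˡ 0ℚ))
∑-linear {suc k} a b f g = trans (cong (a * f zero + b * g zero +_) (∑-linear a b (f ∘ suc) (g ∘ suc)))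
  (solve 6 (λ a b x y X Y → (a :* x :+ b :* y) :+ (a :* X :+ b :* Y) := a :* (x :+ X) :+ b :* (y :+ Y)) refl
    a b (f zero) (g zero) (∑ (f ∘ suc)) (∑ (g ∘ suc)))
  where open +-*-Solver

∑-+ : ∀ {k} (f g : Fin k → ℚ) → ∑ (λ t → f t + g t) ≡ ∑ f + ∑ g
∑-+ {zero}  f g = sym (ℚ.+-identityˡ 0ℚ)
∑-+ {suc k} f g = trans (cong (f zero + g zero +_) (∑-+ (f ∘ suc) (g ∘ suc)))
  (solve 4 (λ x y X Y → (x :+ y) :+ (X :+ Y) := (x :+ X) :+ (y :+ Y)) refl
    (f zero) (g zero) (∑ (f ∘ suc)) (∑ (g ∘ suc)))
  where open +-*-Solver

∑-*ˡ : ∀ {k} a (f : Fin k → ℚ) → ∑ (λ t → a * f t) ≡ a * ∑ f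
∑-*ˡ {zero}  a f = sym (ℚ.*-zeroʳ a)
∑-*ˡ {suc k} a f = trans (cong (a * f zero +_) (∑-*ˡ a (f ∘ suc))) (sym (ℚ.*-distribˡ-+ a _ _))

∑-swap : ∀ {k l} (f : Fin k → Fin l → ℚ) → ∑ (λ s → ∑ (λ t → f s t)) ≡ ∑ (λ t → ∑ (λ s → f s t))
∑-swap {zero} {l} f = sym (∑-zero {l} (λ _ → refl))
∑-swap {suc k} f = trans (cong (∑ (f zero) +_) (∑-swap (f ∘ suc))) (sym (∑-+ (f zero) _))

inverse : ∀ p → p ≢ 0ℚ → Σ ℚ λ q → q * p ≡ 1ℚ
inverse p p≢0 = (1/ p) {{≢-nonZero p≢0}} , ℚ.*-inverseˡ p {{≢-nonZero p≢0}}

*-cancel-≢0 : ∀ c {p} → p ≢ 0ℚ → c * p ≡ 0ℚ → c ≡ 0ℚ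
*-cancel-≢0 c {p} p≢0 cp≡0 with inverse p p≢0
... | y , yp≡1 = begin
  c             ≡⟨ ℚ.*-identityʳ c ⟨
  c * 1ℚ        ≡⟨ cong (c *_) yp≡1 ⟨
  c * (y * p)   ≡⟨ solve 3 (λ c y p → c :* (y :* p) := y :* (c :* p)) refl c y p ⟩
  y * (c * p)   ≡⟨ cong (y *_) cp≡0 ⟩
  y * 0ℚ        ≡⟨ ℚ.*-zeroʳ y ⟩
  0ℚ            ∎
  where open ≡-Reasoning ; open +-*-Solver

LinIndep : {I : Set} {k : ℕ} → (Fin k → I → ℚ) → Set
LinIndep {k = k} v = ∀ (c : Fin k → ℚ) → (∀ i → ∑ (λ t → c t * v t i) ≡ 0ℚ) → ∀ t → c t ≡ 0ℚ

Relation : {I : Set} {k : ℕ} → (Fin k → I → ℚ) → Set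
Relation {k = k} v = Σ (Fin k → ℚ) λ c → (∀ i → ∑ (λ t → c t * v t i) ≡ 0ℚ) × ∃ λ t → c t ≢ 0ℚ

∑-eliminate : ∀ {k} (c a b : Fin k → ℚ) z →
  ∑ (λ t → c t * (a t - b t * z)) ≡ ∑ (λ t → c t * a t) - ∑ (λ t → c t * b t) * z
∑-eliminate {zero}  c a b z = solve 1 (λ z → con 0ℚ := con 0ℚ :- con 0ℚ :* z) refl z
  where open +-*-Solver
∑-eliminate {suc k} c a b z = trans
  (cong (c zero * (a zero - b zero * z) +_) (∑-eliminate (c ∘ suc) (a ∘ suc) (b ∘ suc) z))
  (solve 6 (λ c a b z X Y → c :* (a :- b :* z) :+ (X :- Y :* z) := (c :* a :+ X) :- (c :* b :+ Y) :* z) refl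
    (c zero) (a zero) (b zero) z (∑ (λ t → c (suc t) * a (suc t))) (∑ (λ t → c (suc t) * b (suc t))))
  where open +-*-Solver

-- Gaussian elimination with the first vector as pivot row.
indep-or-relation : ∀ {l K} (M : Fin l → Fin K → ℚ) → (l ℕ.≤ K × LinIndep M) ⊎ Relation M
indep-or-relation {zero} M = inj₁ (z≤n , λ _ _ ())
indep-or-relation {suc l} {K} M with Fin.all? (λ j → M zero j ℚ.≟ 0ℚ)
... | yes M₀≗0 = inj₂ (1ℚ ∷ (λ _ → 0ℚ) , (λ j → trans
        (cong₂ _+_ (trans (ℚ.*-identityˡ _) (M₀≗0 j)) (∑-zero {l} (λ t → ℚ.*-zeroˡ (M (suc t) j)))) (ℚ.+-identityˡ 0ℚ))
        , zero , λ ())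
indep-or-relation {suc l} {zero} M | no M₀≢0 = contradiction (λ ()) M₀≢0
indep-or-relation {suc l} {suc K} M | no M₀≢0
  with Fin.¬∀⟶∃¬ (suc K) (λ j → M zero j ≡ 0ℚ) (λ j → M zero j ℚ.≟ 0ℚ) M₀≢0
... | j , Mⱼ≢0 with inverse (M zero j) Mⱼ≢0
... | y , y*Mⱼ≡1 = lift (indep-or-relation λ t → elim t ∘ punchIn j)
  where
  open +-*-Solver
  v = M zero
  elim : Fin l → Fin (suc K) → ℚ
  elim t c = M (suc t) c - M (suc t) j * (y * v c)

  pivotSum : (Fin l → ℚ) → ℚ
  pivotSum μ = ∑ (λ t → μ t * M (suc t) j)

  elim-off-pivot : ∀ μ → (∀ i → ∑ (λ t → μ t * elim t (punchIn j i)) ≡ 0ℚ) → ∀ c → j ≢ c →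
    ∑ (λ t → μ t * elim t c) ≡ 0ℚ
  elim-off-pivot μ rel c j≢c =
    subst (λ c → ∑ (λ t → μ t * elim t c) ≡ 0ℚ) (Fin.punchIn-punchOut j≢c) (rel (punchOut j≢c))

  lift : (l ℕ.≤ K × LinIndep (λ t → elim t ∘ punchIn j)) ⊎ Relation (λ t → elim t ∘ punchIn j) →
         (suc l ℕ.≤ suc K × LinIndep M) ⊎ Relation M
  -- Elimination subtracts `M (suc t) j * y` times the pivot row from each row; collected over `μ`,
  -- the pivot row receives the coefficient `- (s * y)`.
  lift (inj₂ (μ , rel , t , μₜ≢0)) = inj₂ ((- (s * y)) ∷ μ , rel′ , suc t , μₜ≢0)
    where
    s = pivotSum μ
    rel′ : ∀ c → - (s * y) * v c + ∑ (λ t → μ t * M (suc t) c) ≡ 0ℚ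
    rel′ c with j ≟ c
    ... | yes refl = trans
      (solve 3 (λ s y p → (:- (s :* y)) :* p :+ s := s :* (con 1ℚ :- y :* p)) refl s y (v j))
      (trans (cong (λ z → s * (1ℚ - z)) y*Mⱼ≡1) (ℚ.*-zeroʳ s))
    ... | no j≢c = trans
      (solve 4 (λ s y z X → (:- (s :* y)) :* z :+ X := X :- s :* (y :* z)) refl s y (v c) _)
      (trans (sym (∑-eliminate {l} μ _ _ (y * v c))) (elim-off-pivot μ rel c j≢c))
  lift (inj₁ (l≤K , ind)) = inj₁ (s≤s l≤K , ind′)
    where
    ind′ : LinIndep M
    ind′ μ rel = λ { zero → μ₀≡0 ; (suc t) → tail≡0 t }
      where
      open ≡-Reasoning
      s = pivotSum (μ ∘ suc)
      -- The pivot column of the relation determines `μ zero`; with this value the other columns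
      -- become a relation among the eliminated rows.
      μ₀+sy≡0 : μ zero + s * y ≡ 0ℚ
      μ₀+sy≡0 = begin
        μ zero + s * y                ≡⟨ cong (_+ s * y) (trans (sym (ℚ.*-identityʳ (μ zero))) (cong (μ zero *_) (sym y*Mⱼ≡1))) ⟩
        μ zero * (y * v j) + s * y    ≡⟨ solve 4 (λ m y p s → m :* (y :* p) :+ s :* y := y :* (m :* p :+ s)) refl (μ zero) y (v j) s ⟩
        y * (μ zero * v j + s)        ≡⟨ cong (y *_) (rel j) ⟩
        y * 0ℚ                        ≡⟨ ℚ.*-zeroʳ y ⟩
        0ℚ                            ∎
      tail≡0 : ∀ t → μ (suc t) ≡ 0ℚ
      tail≡0 = ind (μ ∘ suc) λ i → let c = punchIn j i ; X = ∑ (λ t → μ (suc t) * M (suc t) c) in begin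
        ∑ (λ t → μ (suc t) * elim t c)                      ≡⟨ ∑-eliminate (μ ∘ suc) _ _ (y * v c) ⟩
        X - s * (y * v c)                                   ≡⟨ solve 5 (λ X s y z m → X :- s :* (y :* z) := (m :* z :+ X) :- (m :+ s :* y) :* z) refl X s y (v c) (μ zero) ⟩
        (μ zero * v c + X) - (μ zero + s * y) * v c         ≡⟨ cong₂ (λ a b → a - b * v c) (rel c) μ₀+sy≡0 ⟩
        0ℚ - 0ℚ * v c                                       ≡⟨ solve 1 (λ z → con 0ℚ :- con 0ℚ :* z := con 0ℚ) refl (v c) ⟩
        0ℚ                                                  ∎
      μ₀≡0 : μ zero ≡ 0ℚ
      μ₀≡0 = begin
        μ zero            ≡⟨ solve 2 (λ m y → m := m :+ con 0ℚ :* y) refl (μ zero) y ⟩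
        μ zero + 0ℚ * y   ≡⟨ cong (λ z → μ zero + z * y) (sym (∑-zero {l} λ t → trans (cong (_* M (suc t) j) (tail≡0 t)) (ℚ.*-zeroˡ (M (suc t) j)))) ⟩
        μ zero + s * y    ≡⟨ μ₀+sy≡0 ⟩
        0ℚ                ∎

LinSpan : {I : Set} {k : ℕ} → (Fin k → I → ℚ) → (I → ℚ) → Set
LinSpan {k = k} v w = Σ (Fin k → ℚ) λ c → ∀ i → w i ≡ ∑ (λ t → c t * v t i)

record Subspace {I : Set} (P : (I → ℚ) → Set) : Set where
  field
    null : ∀ {w} → (∀ i → w i ≡ 0ℚ) → P w
    comb : ∀ a b {u v w} → P u → P v → (∀ i → w i ≡ a * u i + b * v i) → P w

  ext : ∀ {u w} → P u → (∀ i → w i ≡ u i) → P w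
  ext {u} Pu w≗u = comb 1ℚ 0ℚ Pu Pu λ i → trans (w≗u i)
    (solve 1 (λ x → x := con 1ℚ :* x :+ con 0ℚ :* x) refl (u i))
    where open +-*-Solver

  add : ∀ {u v} → P u → P v → P (λ i → u i + v i)
  add {u} {v} Pu Pv = comb 1ℚ 1ℚ Pu Pv λ i → solve 2 (λ x y → x :+ y := con 1ℚ :* x :+ con 1ℚ :* y) refl (u i) (v i)
    where open +-*-Solver

  sub : ∀ {u v} → P u → P v → P (λ i → u i - v i)
  sub {u} {v} Pu Pv = comb 1ℚ (- 1ℚ) Pu Pv λ i →
    solve 2 (λ x y → x :- y := con 1ℚ :* x :+ con (- 1ℚ) :* y) refl (u i) (v i)
    where open +-*-Solver

  scale : ∀ a {u} → P u → P (λ i → a * u i)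
  scale a {u} Pu = comb a 0ℚ Pu Pu λ i → solve 2 (λ a x → a :* x := a :* x :+ con 0ℚ :* x) refl a (u i)
    where open +-*-Solver

  sum : ∀ {k} {v : Fin k → I → ℚ} → (∀ t → P (v t)) → P (λ i → ∑ (λ t → v t i))
  sum {zero}  Pv = null λ _ → refl
  sum {suc k} Pv = add (Pv zero) (sum (Pv ∘ suc))

LinSpan-subspace : ∀ {I : Set} {k} (v : Fin k → I → ℚ) → Subspace (LinSpan v)
LinSpan-subspace {k = k} v = record
  { null = λ w≗0 → (λ _ → 0ℚ) , λ i → trans (w≗0 i) (sym (∑-zero {k} λ t → ℚ.*-zeroˡ (v t i)))
  ; comb = λ { a b (c , u≗) (d , v≗) w≗ → (λ t → a * c t + b * d t) , λ i → begin
      _  ≡⟨ w≗ i ⟩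
      _  ≡⟨ cong₂ (λ x y → a * x + b * y) (u≗ i) (v≗ i) ⟩
      _  ≡⟨ ∑-linear {k} a b _ _ ⟨
      _  ≡⟨ ∑-cong {k} (λ t → solve 5 (λ a b c d x → a :* (c :* x) :+ b :* (d :* x) := (a :* c :+ b :* d) :* x) refl a b (c t) (d t) (v t i)) ⟩
      _  ∎ }
  }
  where open ≡-Reasoning ; open +-*-Solver

LinSpan-∷ : ∀ {I : Set} {k} (v : Fin k → I → ℚ) a {w} → LinSpan v w → LinSpan (a ∷ v) w
LinSpan-∷ v a (c , w≗) = 0ℚ ∷ c , λ i → trans (w≗ i)
  (sym (trans (cong (_+ ∑ (λ t → c t * v t i)) (ℚ.*-zeroˡ (a i))) (ℚ.+-identityˡ _)))

LinSpan-head : ∀ {I : Set} {k} (v : Fin k → I → ℚ) a → LinSpan (a ∷ v) a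
LinSpan-head {k = k} v a = 1ℚ ∷ (λ _ → 0ℚ) , λ i → sym (trans
  (cong₂ _+_ (ℚ.*-identityˡ (a i)) (∑-zero {k} (λ t → ℚ.*-zeroˡ (v t i)))) (ℚ.+-identityʳ (a i)))

LinSpan-insert : ∀ {I : Set} {k} (v : Fin k → I → ℚ) q a {w} → LinSpan (q ∷ v) w → LinSpan (q ∷ (a ∷ v)) w
LinSpan-insert v q a (c , w≗) = c zero ∷ (0ℚ ∷ (c ∘ suc)) , λ i → trans (w≗ i) (cong (c zero * q i +_)
  (sym (trans (cong (_+ ∑ (λ t → c (suc t) * v t i)) (ℚ.*-zeroˡ (a i))) (ℚ.+-identityˡ _))))

-- Steinitz: with more rows than columns, the coefficient rows admit a relation, and it carries over
-- to the vectors `w`.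
¬LinIndep-in-LinSpan : ∀ {I : Set} {k l} (v : Fin k → I → ℚ) (w : Fin l → I → ℚ) →
  (∀ t → LinSpan v (w t)) → k ℕ.< l → ¬ LinIndep w
¬LinIndep-in-LinSpan {k = k} {l} v w w∈v k<l ind with indep-or-relation (proj₁ ∘ w∈v)
... | inj₁ (l≤k , _) = ℕ.≤⇒≯ l≤k k<l
... | inj₂ (μ , rel , t , μₜ≢0) = μₜ≢0 (ind μ rel′ t)
  where
  open ≡-Reasoning
  rel′ : ∀ i → ∑ (λ t → μ t * w t i) ≡ 0ℚ
  rel′ i = begin
    ∑ (λ t → μ t * w t i)                                      ≡⟨ ∑-cong {l} (λ t → trans (cong (μ t *_) (proj₂ (w∈v t) i)) (sym (∑-*ˡ {k} (μ t) _))) ⟩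
    ∑ (λ t → ∑ (λ s → μ t * (proj₁ (w∈v t) s * v s i)))         ≡⟨ ∑-swap {l} {k} _ ⟩
    ∑ (λ s → ∑ (λ t → μ t * (proj₁ (w∈v t) s * v s i)))         ≡⟨ ∑-zero {k} (λ s → trans (∑-cong {l} (λ t → comm (μ t) _ (v s i))) (trans (∑-*ˡ {l} (v s i) _) (trans (cong (v s i *_) (rel s)) (ℚ.*-zeroʳ (v s i))))) ⟩
    0ℚ                                                         ∎
    where
    open +-*-Solver
    comm : ∀ a b c → a * (b * c) ≡ c * (a * b)
    comm = solve 3 (λ a b c → a :* (b :* c) := c :* (a :* b)) refl

-- Spans and facets

-- The generators form an arbitrary, not enumerated family. A derivation mentions only finitely many
-- of them, so a basis can be extracted by recursion on it. The pointwise equations in the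
-- constructors stand in for function extensionality.
data Span {A I : Set} (g : A → I → ℚ) (S : A → Set) : (I → ℚ) → Set where
  gen       : ∀ {a} → S a → Span g S (g a)
  span-null : ∀ {w} → (∀ i → w i ≡ 0ℚ) → Span g S w
  span-comb : ∀ a b {u v w} → Span g S u → Span g S v → (∀ i → w i ≡ a * u i + b * v i) → Span g S w

Span-subspace : ∀ {A I : Set} (g : A → I → ℚ) (S : A → Set) → Subspace (Span g S)
Span-subspace g S = record { null = span-null ; comb = span-comb }

module BasisExtraction {A I : Set} (g : A → I → ℚ) (S : A → Set) (q : A)
  {K : ℕ} (enum : Fin K → I) (enum-surjective : ∀ i → ∃ λ k → enum k ≡ i) where

  -- There are `suc d` vectors because dimension `d` means `suc d` affinely independent points. The
  -- point `q` is kept apart and enters only through `Spanned`.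
  record Basis : Set where
    field
      d     : ℕ
      B     : Fin (suc d) → A
      B∈S   : ∀ t → S (B t)
      indep : LinIndep (g ∘ B)

  Spanned : Basis → (I → ℚ) → Set
  Spanned b = LinSpan (g q ∷ (g ∘ Basis.B b))

  Spanned-subspace : ∀ b → Subspace (Spanned b)
  Spanned-subspace b = LinSpan-subspace (g q ∷ (g ∘ Basis.B b))

  -- A relation with nonzero head coefficient is solved for `w`; a zero head coefficient would
  -- contradict the independence of `v`.
  indep-or-spanned : ∀ {k} (v : Fin k → I → ℚ) → LinIndep v → ∀ w → LinIndep (w ∷ v) ⊎ LinSpan v w
  indep-or-spanned {k} v ind w with indep-or-relation (λ t → (w ∷ v) t ∘ enum)
  ... | inj₁ (_ , ind′) = inj₁ λ c rel → ind′ c (rel ∘ enum)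
  ... | inj₂ (c , rel , t , cₜ≢0) with c zero ℚ.≟ 0ℚ
  ...   | yes c₀≡0 = contradiction (c≡0 t) cₜ≢0
    where
    drop-head : ∀ i → ∑ (λ t → c (suc t) * v t i) ≡ 0ℚ
    drop-head i with enum-surjective i
    ... | k′ , refl = trans (sym (trans (cong (λ z → z * w i + X) c₀≡0)
      (solve 2 (λ x X → con 0ℚ :* x :+ X := X) refl (w i) X))) (rel k′)
      where
      open +-*-Solver
      X = ∑ (λ t → c (suc t) * v t i)
    c≡0 : ∀ t → c t ≡ 0ℚ
    c≡0 zero    = c₀≡0
    c≡0 (suc t) = ind (c ∘ suc) drop-head t
  ...   | no c₀≢0 with inverse (c zero) c₀≢0
  ...     | y , y*c₀≡1 = inj₂ ((λ t → (- y) * c (suc t)) , expand)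
    where
    open ≡-Reasoning
    expand : ∀ i → w i ≡ ∑ (λ t → (- y) * c (suc t) * v t i)
    expand i with enum-surjective i
    ... | k′ , refl = begin
      w i                                    ≡⟨ ℚ.*-identityˡ (w i) ⟨
      1ℚ * w i                               ≡⟨ cong (_* w i) (sym y*c₀≡1) ⟩
      y * c zero * w i                       ≡⟨ solve 4 (λ y c w X → y :* c :* w := y :* (c :* w :+ X) :+ (:- y) :* X) refl y (c zero) (w i) X ⟩
      y * (c zero * w i + X) + (- y) * X     ≡⟨ cong (λ z → y * z + (- y) * X) (rel k′) ⟩
      y * 0ℚ + (- y) * X                     ≡⟨ solve 2 (λ y X → y :* con 0ℚ :+ (:- y) :* X := (:- y) :* X) refl y X ⟩
      (- y) * X                              ≡⟨ ∑-*ˡ {k} (- y) _ ⟨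
      ∑ (λ t → (- y) * (c (suc t) * v t i))  ≡⟨ ∑-cong {k} (λ t → sym (ℚ.*-assoc (- y) (c (suc t)) (v t i))) ⟩
      ∑ (λ t → (- y) * c (suc t) * v t i)    ∎
      where
      open +-*-Solver
      X = ∑ (λ t → c (suc t) * v t i)

  -- Recursion on the derivation: each generator from `S` is already spanned or joins the basis. It
  -- is tested against `B` without `q`, since the extracted vectors must be independent and lie in
  -- `S`.
  extend : (b : Basis) → ∀ {w} → Span g (λ a → S a ⊎ a ≡ q) w →
           Σ Basis λ b′ → (∀ {u} → Spanned b u → Spanned b′ u) × Spanned b′ w
  extend b (gen (inj₂ refl)) = b , (λ u → u) , LinSpan-head (g ∘ Basis.B b) (g q)
  extend b (gen {a} (inj₁ Sa)) with indep-or-spanned (g ∘ Basis.B b) (Basis.indep b) (g a)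
  ... | inj₂ a∈B = b , (λ u → u) , LinSpan-∷ (g ∘ Basis.B b) (g q) a∈B
  ... | inj₁ ind = record { d = suc (Basis.d b) ; B = a ∷ Basis.B b ; B∈S = λ { zero → Sa ; (suc t) → Basis.B∈S b t } ; indep = ind }
      , (λ {u} → LinSpan-insert (g ∘ Basis.B b) (g q) (g a) {u})
      , LinSpan-∷ (g a ∷ (g ∘ Basis.B b)) (g q) (LinSpan-head (g ∘ Basis.B b) (g a))
  extend b (span-null w≗0) = b , (λ u → u) , Subspace.null (Spanned-subspace b) w≗0
  extend b (span-comb α β u v w≗) with extend b u
  ... | b₁ , b⊑b₁ , u∈b₁ with extend b₁ v
  ... | b₂ , b₁⊑b₂ , v∈b₂ =
    b₂ , (λ z → b₁⊑b₂ (b⊑b₁ z)) , Subspace.comb (Spanned-subspace b₂) α β (b₁⊑b₂ u∈b₁) v∈b₂ w≗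

  extend-all : (b : Basis) → ∀ {r} (w : Fin r → I → ℚ) → (∀ k → Span g (λ a → S a ⊎ a ≡ q) (w k)) →
               Σ Basis λ b′ → (∀ {u} → Spanned b u → Spanned b′ u) × (∀ k → Spanned b′ (w k))
  extend-all b {zero}  w w∈ = b , (λ u → u) , λ ()
  extend-all b {suc r} w w∈ with extend b (w∈ zero)
  ... | b₁ , b⊑b₁ , w₀∈b₁ with extend-all b₁ (w ∘ suc) (w∈ ∘ suc)
  ... | b₂ , b₁⊑b₂ , w∈b₂ =
    b₂ , (λ z → b₁⊑b₂ (b⊑b₁ z)) , λ { zero → b₁⊑b₂ w₀∈b₁ ; (suc k) → w∈b₂ k }

-- Linearity as preservation of linear relations, the form in which it meets affine independence.
Linear : ∀ {n} → (Point n → ℚ) → Set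
Linear {n} H = ∀ {k} (c : Fin k → ℚ) (x : Fin k → Point n) →
  (∀ i j → ∑ (λ t → c t * x t i j) ≡ 0ℚ) → ∑ (λ t → c t * H (x t)) ≡ 0ℚ

-- Applying `H` to an affine relation kills every term but that of `p`, whose coefficient must
-- therefore vanish.
AffIndep-∷ : ∀ {n k} (H : Point n → ℚ) → Linear H → (p : Point n) (x : Fin k → Point n) →
  AffIndep x → (∀ t → H (x t) ≡ 0ℚ) → H p ≢ 0ℚ → AffIndep (p ∷ x)
AffIndep-∷ {n} {k} H lin p x ind Hx≡0 Hp≢0 c ∑c≡0 rel = λ { zero → c₀≡0 ; (suc t) → tail≡0 t }
  where
  drop : ∀ y X → c zero * y + X ≡ 0ℚ → c zero ≡ 0ℚ → X ≡ 0ℚ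
  drop y X eq c₀≡0 = trans (sym (trans (cong (λ z → z * y + X) c₀≡0)
    (solve 2 (λ y X → con 0ℚ :* y :+ X := X) refl y X))) eq
    where open +-*-Solver
  c₀≡0 : c zero ≡ 0ℚ
  c₀≡0 = *-cancel-≢0 (c zero) Hp≢0 (trans (sym (ℚ.+-identityʳ (c zero * H p)))
    (trans (cong (c zero * H p +_) (sym (∑-zero {k} λ t → trans (cong (c (suc t) *_) (Hx≡0 t)) (ℚ.*-zeroʳ (c (suc t))))))
           (lin c (p ∷ x) rel)))
  tail≡0 : ∀ t → c (suc t) ≡ 0ℚ
  tail≡0 = ind (c ∘ suc)
    (drop 1ℚ (∑ (c ∘ suc)) (trans (cong (_+ ∑ (c ∘ suc)) (ℚ.*-identityʳ (c zero))) ∑c≡0) c₀≡0)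
    (λ i j → drop (p i j) _ (rel i j) c₀≡0)

-- Unit vectors of edges

δ : ∀ {k} → Fin k → Fin k → ℚ
δ zero    zero    = 1ℚ
δ zero    (suc _) = 0ℚ
δ (suc _) zero    = 0ℚ
δ (suc i) (suc j) = δ i j

δ-refl : ∀ {k} (i : Fin k) → δ i i ≡ 1ℚ
δ-refl zero    = refl
δ-refl (suc i) = δ-refl i

δ-≢ : ∀ {k} {i j : Fin k} → i ≢ j → δ i j ≡ 0ℚ
δ-≢ {i = zero}  {zero}  i≢j = contradiction refl i≢j
δ-≢ {i = zero}  {suc j} i≢j = refl
δ-≢ {i = suc i} {zero}  i≢j = refl
δ-≢ {i = suc i} {suc j} i≢j = δ-≢ (i≢j ∘ cong suc)

∑-δ : ∀ {k} (f : Fin k → ℚ) j → ∑ (λ v → f v * δ v j) ≡ f j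
∑-δ {suc k} f zero = trans (cong₂ _+_ (ℚ.*-identityʳ (f zero)) (∑-zero {k} λ t → ℚ.*-zeroʳ (f (suc t))))
  (ℚ.+-identityʳ (f zero))
∑-δ {suc k} f (suc j) = trans (cong₂ _+_ (ℚ.*-zeroʳ (f zero)) (∑-δ (f ∘ suc) j)) (ℚ.+-identityˡ (f (suc j)))

-- Homogeneous coordinates: `nothing` is the extra coordinate, equal to 1 on points of the polytope,
-- which turns affine into linear independence.
Coord : ℕ → Set
Coord n = Maybe (Fin n × Fin n)

coord : ∀ {n} → Fin (suc (n ℕ.* n)) → Coord n
coord         zero    = nothing
coord {n = n} (suc k) = just (remQuot n k)

coord-surjective : ∀ {n} (i : Coord n) → ∃ λ k → coord k ≡ i
coord-surjective nothing        = zero , refl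
coord-surjective (just (i , j)) = suc (combine i j) , cong just (Fin.remQuot-combine i j)

-- The unit vector of the edge `uv` in the symmetric encoding, with entry 1 at both ordered pairs.
-- The homogenising coordinate is 0 because this is a direction, not a point.
τ : ∀ {n} → Fin n → Fin n → Coord n → ℚ
τ u v nothing        = 0ℚ
τ u v (just (i , j)) = δ u i * δ v j + δ v i * δ u j

τ-comm : ∀ {n} (u v : Fin n) c → τ v u c ≡ τ u v c
τ-comm u v nothing        = refl
τ-comm u v (just (i , j)) = ℚ.+-comm (δ v i * δ u j) (δ u i * δ v j)

τ-self : ∀ {n} {u v : Fin n} → u ≢ v → τ u v (just (u , v)) ≡ 1ℚ
τ-self {u = u} {v} u≢v rewrite δ-refl u | δ-refl v | δ-≢ u≢v | δ-≢ (u≢v ∘ sym) = refl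

τ-off : ∀ {n} {u v i j : Fin n} → ¬ (u ≡ i × v ≡ j) → ¬ (v ≡ i × u ≡ j) → τ u v (just (i , j)) ≡ 0ℚ
τ-off {u = u} {v} {i} {j} ≢uv ≢vu = cong₂ _+_ (vanish u i v j ≢uv) (vanish v i u j ≢vu)
  where
  vanish : ∀ {n} (a b c d : Fin n) → ¬ (a ≡ b × c ≡ d) → δ a b * δ c d ≡ 0ℚ
  vanish a b c d ≢ with a ≟ b | c ≟ d
  ... | yes p | yes q = contradiction (p , q) ≢
  ... | no p  | _     = trans (cong (_* δ c d) (δ-≢ p)) (ℚ.*-zeroˡ (δ c d))
  ... | yes _ | no p  = trans (cong (δ a b *_) (δ-≢ p)) (ℚ.*-zeroʳ (δ a b))

Symmetric : ∀ {n} → (Coord n → ℚ) → Set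
Symmetric D = ∀ i j → D (just (i , j)) ≡ D (just (j , i))

-- Summing `D (just (u , v)) * τ u v` over all ordered pairs gives twice `D`, since an unordered
-- pair occurs twice and `τ u u` has entry 2 on the diagonal; hence the factor `½`.
supported : ∀ {n} {P : (Coord n → ℚ) → Set} → Subspace P → (D : Coord n → ℚ) → D nothing ≡ 0ℚ → Symmetric D →
  (∀ i j → D (just (i , j)) ≡ 0ℚ ⊎ P (τ i j)) → P D
supported {n} {P} sub D D₀≡0 D-sym supp = ext (scale ½ (sum λ u → sum λ v → term u v)) expand
  where
  open Subspace sub hiding (sub)
  open ≡-Reasoning
  open +-*-Solver
  term : ∀ u v → P (λ c → D (just (u , v)) * τ u v c)
  term u v with supp u v
  ... | inj₁ D≡0 = null λ c → trans (cong (_* τ u v c) D≡0) (ℚ.*-zeroˡ (τ u v c))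
  ... | inj₂ Pτ  = scale (D (just (u , v))) Pτ
  inner : ∀ i j u → ∑ (λ v → D (just (u , v)) * τ u v (just (i , j)))
                  ≡ D (just (u , j)) * δ u i + D (just (u , i)) * δ u j
  inner i j u = begin
    ∑ (λ v → D (just (u , v)) * τ u v (just (i , j)))
      ≡⟨ ∑-cong {n} (λ v → solve 5 (λ d a b e f → d :* (a :* b :+ e :* f) := d :* a :* b :+ d :* f :* e) refl
           (D (just (u , v))) (δ u i) (δ v j) (δ v i) (δ u j)) ⟩
    ∑ (λ v → D (just (u , v)) * δ u i * δ v j + D (just (u , v)) * δ u j * δ v i)
      ≡⟨ ∑-+ {n} _ _ ⟩
    ∑ (λ v → D (just (u , v)) * δ u i * δ v j) + ∑ (λ v → D (just (u , v)) * δ u j * δ v i)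
      ≡⟨ cong₂ _+_ (∑-δ (λ v → D (just (u , v)) * δ u i) j) (∑-δ (λ v → D (just (u , v)) * δ u j) i) ⟩
    D (just (u , j)) * δ u i + D (just (u , i)) * δ u j ∎
  expand : ∀ c → D c ≡ ½ * ∑ (λ u → ∑ (λ v → D (just (u , v)) * τ u v c))
  expand nothing = trans D₀≡0 (sym (trans (cong (½ *_) (∑-zero {n} λ u → ∑-zero {n} λ v → ℚ.*-zeroʳ (D (just (u , v))))) (ℚ.*-zeroʳ ½)))
  expand (just (i , j)) = sym (begin
    ½ * ∑ (λ u → ∑ (λ v → D (just (u , v)) * τ u v (just (i , j))))
      ≡⟨ cong (½ *_) (∑-cong {n} (inner i j)) ⟩
    ½ * ∑ (λ u → D (just (u , j)) * δ u i + D (just (u , i)) * δ u j)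
      ≡⟨ cong (½ *_) (∑-+ {n} _ _) ⟩
    ½ * (∑ (λ u → D (just (u , j)) * δ u i) + ∑ (λ u → D (just (u , i)) * δ u j))
      ≡⟨ cong (½ *_) (cong₂ _+_ (∑-δ (λ u → D (just (u , j))) i) (trans (∑-δ (λ u → D (just (u , i))) j) (D-sym j i))) ⟩
    ½ * (D (just (i , j)) + D (just (i , j)))
      ≡⟨ solve 1 (λ x → con ½ :* (x :+ x) := x) refl (D (just (i , j))) ⟩
    D (just (i , j)) ∎)

module _ {n : ℕ} (Ĝ : Graph n) where

  χ-same : ∀ (ℓ : Labelling n) {i j} → ℓ i ≡ ℓ j → χ Ĝ ℓ i j ≡ 0ℚ
  χ-same ℓ {i} {j} eq with Ĝ i j
  ... | false = refl
  ... | true with ℓ i ≟ ℓ j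
  ...   | yes _ = refl
  ...   | no ne = contradiction eq ne

  χ-diff : ∀ (ℓ : Labelling n) {i j} → Ĝ i j ≡ true → ℓ i ≢ ℓ j → χ Ĝ ℓ i j ≡ 1ℚ
  χ-diff ℓ {i} {j} e ne rewrite e with ℓ i ≟ ℓ j
  ... | yes eq = contradiction eq ne
  ... | no _   = refl

  χ-nonedge : ∀ (ℓ : Labelling n) {i j} → Ĝ i j ≡ false → χ Ĝ ℓ i j ≡ 0ℚ
  χ-nonedge ℓ e rewrite e = refl

  hat : Labelling n → Coord n → ℚ
  hat ℓ nothing        = 1ℚ
  hat ℓ (just (i , j)) = χ Ĝ ℓ i j

  AffIndep⇒LinIndep : ∀ {k} (ls : Fin k → Labelling n) → AffIndep (χ Ĝ ∘ ls) → LinIndep (hat ∘ ls)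
  AffIndep⇒LinIndep {k} ls ind c rel = ind c
    (trans (∑-cong {k} λ t → sym (ℚ.*-identityʳ (c t))) (rel nothing)) (λ i j → rel (just (i , j)))

  LinIndep⇒AffIndep : ∀ {k} (ls : Fin k → Labelling n) → LinIndep (hat ∘ ls) → AffIndep (χ Ĝ ∘ ls)
  LinIndep⇒AffIndep {k} ls ind c ∑c≡0 rel = ind c λ
    { nothing        → trans (∑-cong {k} λ t → ℚ.*-identityʳ (c t)) ∑c≡0
    ; (just (i , j)) → rel i j }

  module _ (Ĝ-sym : ∀ i j → Ĝ i j ≡ Ĝ j i) where

    χ-sym : ∀ ℓ i j → χ Ĝ ℓ i j ≡ χ Ĝ ℓ j i
    χ-sym ℓ i j with Ĝ i j in eᵢⱼ
    ... | false = sym (χ-nonedge ℓ (trans (Ĝ-sym j i) eᵢⱼ))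
    ... | true with ℓ i ≟ ℓ j
    ...   | yes eq = sym (χ-same ℓ (sym eq))
    ...   | no ne  = sym (χ-diff ℓ (trans (Ĝ-sym j i) eᵢⱼ) (ne ∘ sym))

    -- If passing from ℓ′ to the coarser ℓ joins, besides uv, only edges whose unit vectors are already
    -- spanned, then the unit vector of uv is spanned as well.
    isolate : ∀ {S : Labelling n → Set} (ℓ ℓ′ : Labelling n) → S ℓ → S ℓ′ → (K N : Fin n → Set) → ∀ {u v} →
      Ĝ u v ≡ true → ℓ u ≡ ℓ v → ℓ′ u ≢ ℓ′ v →
      (∀ i j → ℓ′ i ≡ ℓ′ j → ℓ i ≡ ℓ j) →
      (∀ i j → ℓ i ≡ ℓ j → ℓ′ i ≡ ℓ′ j ⊎ (K i × N j) ⊎ (N i × K j)) →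
      (∀ i j → K i → N j → Ĝ i j ≡ true → (u ≡ i × v ≡ j) ⊎ Span hat S (τ i j)) →
      Span hat S (τ u v)
    isolate {S} ℓ ℓ′ Sℓ Sℓ′ K N {u} {v} uv∈Ĝ ℓuv ℓ′uv coarser joined good =
      ext (sub (sub (gen Sℓ′) (gen Sℓ)) (supported (Span-subspace hat S) D refl D-sym D-supp))
        λ c → solve 3 (λ a b t → t := (a :- b) :- ((a :- b) :- t)) refl (hat ℓ′ c) (hat ℓ c) (τ u v c)
      where
      open Subspace (Span-subspace hat S) using (ext; sub)
      open +-*-Solver
      u≢v : u ≢ v
      u≢v refl = ℓ′uv refl
      -- The difference with its entry at `uv` removed: every other nonzero entry belongs to an edge
      -- whose unit vector is spanned by hypothesis.
      D : Coord n → ℚ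
      D c = (hat ℓ′ c - hat ℓ c) - τ u v c
      τ-sym : ∀ i j → τ u v (just (i , j)) ≡ τ u v (just (j , i))
      τ-sym i j = solve 4 (λ a b c d → a :* b :+ c :* d := d :* c :+ b :* a) refl (δ u i) (δ v j) (δ v i) (δ u j)
      D-sym : Symmetric D
      D-sym i j = cong₂ _-_ (cong₂ _-_ (χ-sym ℓ′ i j) (χ-sym ℓ i j)) (τ-sym i j)
      D-uv : D (just (u , v)) ≡ 0ℚ
      D-uv = cong₂ _-_ (cong₂ _-_ (χ-diff ℓ′ uv∈Ĝ ℓ′uv) (χ-same ℓ ℓuv)) (τ-self u≢v)
      D-off : ∀ {i j} → ¬ (u ≡ i × v ≡ j) → ¬ (v ≡ i × u ≡ j) → χ Ĝ ℓ′ i j ≡ χ Ĝ ℓ i j → D (just (i , j)) ≡ 0ℚ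
      D-off {i} {j} ≢uv ≢vu eq = trans (cong₂ (λ a b → (a - χ Ĝ ℓ i j) - b) eq (τ-off ≢uv ≢vu))
        (solve 1 (λ a → (a :- a) :- con 0ℚ := con 0ℚ) refl (χ Ĝ ℓ i j))
      spanned-if-joined : ∀ {i j} → ¬ (u ≡ i × v ≡ j) → ¬ (v ≡ i × u ≡ j) → Ĝ i j ≡ true → ℓ i ≡ ℓ j →
        ℓ′ i ≡ ℓ′ j ⊎ (K i × N j) ⊎ (N i × K j) → D (just (i , j)) ≡ 0ℚ ⊎ Span hat S (τ i j)
      spanned-if-joined ≢uv ≢vu ij∈Ĝ ℓij (inj₁ ℓ′ij) =
        inj₁ (D-off ≢uv ≢vu (trans (χ-same ℓ′ ℓ′ij) (sym (χ-same ℓ ℓij))))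
      spanned-if-joined {i} {j} ≢uv ≢vu ij∈Ĝ ℓij (inj₂ (inj₁ (Ki , Nj))) with good i j Ki Nj ij∈Ĝ
      ... | inj₁ ≡uv = contradiction ≡uv ≢uv
      ... | inj₂ Gij = inj₂ Gij
      spanned-if-joined {i} {j} ≢uv ≢vu ij∈Ĝ ℓij (inj₂ (inj₂ (Ni , Kj)))
        with good j i Kj Ni (trans (Ĝ-sym j i) ij∈Ĝ)
      ... | inj₁ (u≡j , v≡i) = contradiction (v≡i , u≡j) ≢vu
      ... | inj₂ Gji = inj₂ (ext Gji (τ-comm j i))
      supp : ∀ {i j} → ¬ (u ≡ i × v ≡ j) → ¬ (v ≡ i × u ≡ j) → ∀ b → Ĝ i j ≡ b →
        D (just (i , j)) ≡ 0ℚ ⊎ Span hat S (τ i j)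
      supp ≢uv ≢vu false ij∉Ĝ = inj₁ (D-off ≢uv ≢vu (trans (χ-nonedge ℓ′ ij∉Ĝ) (sym (χ-nonedge ℓ ij∉Ĝ))))
      supp {i} {j} ≢uv ≢vu true ij∈Ĝ = case ℓ i ≟ ℓ j of λ
        { (yes ℓij) → spanned-if-joined ≢uv ≢vu ij∈Ĝ ℓij (joined i j ℓij)
        ; (no ℓij)  → inj₁ (D-off ≢uv ≢vu (trans (χ-diff ℓ′ ij∈Ĝ (ℓij ∘ coarser i j)) (sym (χ-diff ℓ ij∈Ĝ ℓij)))) }
      D-supp : ∀ i j → D (just (i , j)) ≡ 0ℚ ⊎ Span hat S (τ i j)
      D-supp i j with (u ≟ i) ×-dec (v ≟ j) | (v ≟ i) ×-dec (u ≟ j)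
      ... | yes (refl , refl) | _                 = inj₁ D-uv
      ... | no _              | yes (refl , refl) = inj₁ (trans (D-sym v u) D-uv)
      ... | no ≢uv            | no ≢vu            = supp ≢uv ≢vu (Ĝ i j) refl

  -- No dimension is computed: a basis extracted from the face, together with q, spans all points.
  spanning⇒facet : (∀ i j → Ĝ i j ≡ Ĝ j i) → (E : Graph n) (lhs rhs : Point n → ℚ) →
    (∀ ℓ → IsDecomposition E ℓ → lhs (χ Ĝ ℓ) ≤ rhs (χ Ĝ ℓ)) →
    let Face = λ ℓ → IsDecomposition E ℓ × lhs (χ Ĝ ℓ) ≡ rhs (χ Ĝ ℓ) in
    (H : Point n → ℚ) → Linear H → (∀ ℓ → Face ℓ → H (χ Ĝ ℓ) ≡ 0ℚ) →
    (q : Labelling n) → IsDecomposition E q → H (χ Ĝ q) ≢ 0ℚ →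
    (ℓ₀ : Labelling n) → Face ℓ₀ →
    (∀ i j → Ĝ i j ≡ true → Span hat (λ ℓ → Face ℓ ⊎ ℓ ≡ q) (τ i j)) →
    DefinesFacet E Ĝ lhs rhs
  spanning⇒facet Ĝ-sym E lhs rhs valid H lin H-face q q-dec Hq≢0 ℓ₀ face₀ good = valid , d , dims
    where
    Face = λ ℓ → IsDecomposition E ℓ × lhs (χ Ĝ ℓ) ≡ rhs (χ Ĝ ℓ)
    open BasisExtraction hat Face q coord coord-surjective
    open +-*-Solver

    with-q : ∀ {k} → HasAffIndep Ĝ Face k → HasAffIndep Ĝ (IsDecomposition E) (suc k)
    with-q (ls , ls∈ , ind) = q ∷ ls , (λ { zero → q-dec ; (suc t) → proj₁ (ls∈ t) }) ,
      λ c → indep c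
      where
      indep : AffIndep (χ Ĝ q ∷ (χ Ĝ ∘ ls))
      indep = AffIndep-∷ H lin (χ Ĝ q) (χ Ĝ ∘ ls) ind (λ t → H-face (ls t) (ls∈ t)) Hq≢0

    -- A single point is independent because its homogenising coordinate is 1. Starting from it,
    -- every other point differs by a vector supported on edges, so unit vectors suffice.
    b₀ : Basis
    b₀ = record { d = 0 ; B = λ _ → ℓ₀ ; B∈S = λ _ → face₀ ; indep = λ c rel → λ
      { zero → trans (solve 1 (λ x → x := x :* con 1ℚ :+ con 0ℚ) refl (c zero)) (rel nothing) } }

    -- Basis extraction runs over all pairs, so non-edges contribute the zero vector as a default.
    target : Fin n → Fin n → Coord n → ℚ
    target i j = if Ĝ i j then τ i j else λ _ → 0ℚ

    target-spanned : ∀ i j → Span hat (λ ℓ → Face ℓ ⊎ ℓ ≡ q) (target i j)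
    target-spanned i j with Ĝ i j in ij∈Ĝ
    ... | true  = good i j ij∈Ĝ
    ... | false = span-null λ _ → refl

    final = extend-all b₀ {n ℕ.* n} (λ k → uncurry target (remQuot n k)) (λ k → target-spanned _ _)
    b = proj₁ final
    open Basis b using (d; B; B∈S; indep)

    τ-spanned : ∀ i j → Ĝ i j ≡ true → Spanned b (τ i j)
    τ-spanned i j ij∈Ĝ = Subspace.ext (Spanned-subspace b) (proj₂ (proj₂ final) (combine i j)) eq
      where
      eq : ∀ c → τ i j c ≡ uncurry target (remQuot {n} n (combine i j)) c
      eq c = trans (sym (cong (λ b → (if b then τ i j else λ _ → 0ℚ) c) ij∈Ĝ))
        (cong (λ z → uncurry target z c) (sym (Fin.remQuot-combine {n} {n} i j)))

    everything-spanned : ∀ ℓ → Spanned b (hat ℓ)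
    everything-spanned ℓ = ext (add hat₀ (supported (Spanned-subspace b) D refl D-sym D-supp))
      λ c → solve 2 (λ a b → a := b :+ (a :- b)) refl (hat ℓ c) (hat ℓ₀ c)
      where
      open Subspace (Spanned-subspace b) using (ext; add)
      hat₀ : Spanned b (hat ℓ₀)
      hat₀ = proj₁ (proj₂ final) {hat ℓ₀} (LinSpan-∷ (λ _ → hat ℓ₀) (hat q) (LinSpan-head {k = 0} (λ ()) (hat ℓ₀)))
      D : Coord n → ℚ
      D c = hat ℓ c - hat ℓ₀ c
      D-sym : Symmetric D
      D-sym i j = cong₂ _-_ (χ-sym Ĝ-sym ℓ i j) (χ-sym Ĝ-sym ℓ₀ i j)
      D-supp : ∀ i j → D (just (i , j)) ≡ 0ℚ ⊎ Spanned b (τ i j)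
      D-supp i j with Ĝ i j in ij∈Ĝ
      ... | false = inj₁ refl
      ... | true  = inj₂ (τ-spanned i j ij∈Ĝ)

    face-indep : HasAffIndep Ĝ Face (suc d)
    face-indep = B , B∈S , LinIndep⇒AffIndep B indep

    dim-bound : ¬ HasAffIndep Ĝ (IsDecomposition E) (suc (suc (suc d)))
    dim-bound (ls , _ , ind) = ¬LinIndep-in-LinSpan (hat q ∷ (hat ∘ B)) (hat ∘ ls)
      (everything-spanned ∘ ls) ℕ.≤-refl (AffIndep⇒LinIndep ls ind)

    -- Adjoining `q` serves twice: it lifts the face basis to the polytope, and it turns too many
    -- independent points of the face into too many of the polytope.
    dims : AffDim Ĝ Face d × AffDim Ĝ (IsDecomposition E) (suc d)
    dims = (face-indep , dim-bound ∘ with-q) , (with-q face-indep , dim-bound)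

  -- The values of `H₁` and `H₂` on the face, `q₁` and `q₂` are triangular, so both points can be
  -- adjoined in this order. The polytope then exceeds the dimension of the face by at least two.
  two-equations⇒¬facet : (E : Graph n) (lhs rhs : Point n → ℚ) →
    let Face = λ ℓ → IsDecomposition E ℓ × lhs (χ Ĝ ℓ) ≡ rhs (χ Ĝ ℓ) in
    (H₁ H₂ : Point n → ℚ) → Linear H₁ → Linear H₂ →
    (∀ ℓ → Face ℓ → H₁ (χ Ĝ ℓ) ≡ 0ℚ) → (∀ ℓ → Face ℓ → H₂ (χ Ĝ ℓ) ≡ 0ℚ) →
    (q₁ q₂ : Labelling n) → IsDecomposition E q₁ → IsDecomposition E q₂ →
    H₁ (χ Ĝ q₁) ≢ 0ℚ → H₂ (χ Ĝ q₁) ≡ 0ℚ → H₂ (χ Ĝ q₂) ≢ 0ℚ →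
    ¬ DefinesFacet E Ĝ lhs rhs
  two-equations⇒¬facet E lhs rhs H₁ H₂ lin₁ lin₂ face₁ face₂ q₁ q₂ dec₁ dec₂ H₁q₁≢0 H₂q₁≡0 H₂q₂≢0
    (_ , d , ((ls , ls∈ , ind) , _) , (_ , dim-bound)) =
    dim-bound (q₂ ∷ (q₁ ∷ ls) , (λ { zero → dec₂ ; (suc zero) → dec₁ ; (suc (suc t)) → proj₁ (ls∈ t) }) , λ c → indep₂ c)
    where
    indep₁ : AffIndep (χ Ĝ q₁ ∷ (χ Ĝ ∘ ls))
    indep₁ = AffIndep-∷ H₁ lin₁ (χ Ĝ q₁) (χ Ĝ ∘ ls) ind (λ t → face₁ (ls t) (ls∈ t)) H₁q₁≢0
    indep₂ : AffIndep (χ Ĝ q₂ ∷ (χ Ĝ q₁ ∷ (χ Ĝ ∘ ls)))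
    indep₂ = AffIndep-∷ H₂ lin₂ (χ Ĝ q₂) (χ Ĝ q₁ ∷ (χ Ĝ ∘ ls)) indep₁
      (λ { zero → H₂q₁≡0 ; (suc t) → face₂ (ls t) (ls∈ t) }) H₂q₂≢0

-- Decompositions with two nontrivial blocks

module _ {n : ℕ} {E : Graph n} where

  reach-end : ∀ {S i j} → Reach E S i j → S j
  reach-end (here Si)    = Si
  reach-end (step _ _ r) = reach-end r

  reach-trans : ∀ {S i j k} → Reach E S i j → Reach E S j k → Reach E S i k
  reach-trans (here _)     r′ = r′
  reach-trans (step s e r) r′ = step s e (reach-trans r r′)

  reach-mono : ∀ {S T : Fin n → Set} → (∀ x → S x → T x) → ∀ {i j} → Reach E S i j → Reach E T i j
  reach-mono S⊆T (here s)     = here (S⊆T _ s)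
  reach-mono S⊆T (step s e r) = step (S⊆T _ s) e (reach-mono S⊆T r)

  reach-start : ∀ {S i j} → Reach E S i j → S i
  reach-start (here s)     = s
  reach-start (step s _ _) = s

  reach-sym : (∀ i j → E i j ≡ E j i) → ∀ {S i j} → Reach E S i j → Reach E S j i
  reach-sym E-sym (here s)     = here s
  reach-sym E-sym (step s e r) =
    reach-trans (reach-sym E-sym r) (step (reach-start r) (trans (E-sym _ _) e) (here s))

-- Nodes outside A and B form singleton blocks; the hubs a and b witness connectedness.
record Blocks {n : ℕ} (E : Graph n) : Set₁ where
  field
    A B      : Fin n → Set
    A?       : ∀ x → Dec (A x)
    B?       : ∀ x → Dec (B x)
    disjoint : ∀ {x} → A x → ¬ B x
    a b      : Fin n
    to-a     : ∀ {x} → A x → Reach E A x a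
    to-b     : ∀ {x} → B x → Reach E B x b

  Same : Fin n → Fin n → Set
  Same x y = x ≡ y ⊎ (A x × A y) ⊎ (B x × B y)

  lab : Labelling n
  lab x with A? x | B? x
  ... | yes _ | _     = a
  ... | no _  | yes _ = b
  ... | no _  | no _  = x

  lab-A : ∀ {x} → A x → lab x ≡ a
  lab-A {x} Ax with A? x | B? x
  ... | yes _  | _ = refl
  ... | no ¬Ax | _ = contradiction Ax ¬Ax

  lab-B : ∀ {x} → B x → lab x ≡ b
  lab-B {x} Bx with A? x | B? x
  ... | yes Ax | _      = contradiction Bx (disjoint Ax)
  ... | no _   | yes _  = refl
  ... | no _   | no ¬Bx = contradiction Bx ¬Bx

  lab-same : ∀ {x y} → Same x y → lab x ≡ lab y
  lab-same (inj₁ refl)             = refl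
  lab-same (inj₂ (inj₁ (Ax , Ay))) = trans (lab-A Ax) (sym (lab-A Ay))
  lab-same (inj₂ (inj₂ (Bx , By))) = trans (lab-B Bx) (sym (lab-B By))

  lab-reflect : ∀ x y → lab x ≡ lab y → Same x y
  lab-reflect x y eq with A? x | B? x | A? y | B? y
  ... | yes Ax | _      | yes Ay | _      = inj₂ (inj₁ (Ax , Ay))
  ... | yes Ax | _      | no _   | yes By =
    contradiction (reach-end (to-b By)) (disjoint (subst A eq (reach-end (to-a Ax))))
  ... | yes Ax | _      | no ¬Ay | no _   = contradiction (subst A eq (reach-end (to-a Ax))) ¬Ay
  ... | no _   | yes Bx | yes Ay | _      =
    contradiction (reach-end (to-b Bx)) (disjoint (subst A (sym eq) (reach-end (to-a Ay))))
  ... | no _   | yes Bx | no _   | yes By = inj₂ (inj₂ (Bx , By))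
  ... | no _   | yes Bx | no _   | no ¬By = contradiction (subst B eq (reach-end (to-b Bx))) ¬By
  ... | no ¬Ax | no _   | yes Ay | _      = contradiction (subst A (sym eq) (reach-end (to-a Ay))) ¬Ax
  ... | no _   | no ¬Bx | no _   | yes By = contradiction (subst B (sym eq) (reach-end (to-b By))) ¬Bx
  ... | no _   | no _   | no _   | no _   = inj₁ eq

  lab-decomposition : (∀ i j → E i j ≡ E j i) → IsDecomposition E lab
  lab-decomposition E-sym i j eq with lab-reflect i j eq
  ... | inj₁ refl             = here refl
  ... | inj₂ (inj₁ (Ai , Aj)) = reach-mono (λ k Ak → lab-same (inj₂ (inj₁ (Ak , Ai))))
    (reach-trans (to-a Ai) (reach-sym E-sym (to-a Aj)))
  ... | inj₂ (inj₂ (Bi , Bj)) = reach-mono (λ k Bk → lab-same (inj₂ (inj₂ (Bk , Bi))))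
    (reach-trans (to-b Bi) (reach-sym E-sym (to-b Bj)))

-- Comparing a decomposition with a refinement

module _ {n : ℕ} {E Ĝ : Graph n} (Ĝ-sym : ∀ i j → Ĝ i j ≡ Ĝ j i) {S : Labelling n → Set} where
  open Blocks

  Good : Fin n → Fin n → Set
  Good i j = Span (hat Ĝ) S (τ i j)

  Good-sym : ∀ {i j} → Good i j → Good j i
  Good-sym {i} {j} Gij = Subspace.ext (Span-subspace (hat Ĝ) S) Gij (τ-comm i j)

  -- When `z` leaves the block `A`, the newly cut edges are exactly those from `z` to the rest of
  -- `A`.
  isolate-drop : (X X′ : Blocks E) → S (lab X) → S (lab X′) → ∀ z → A X z → ¬ A X′ z →
    (∀ {x} → A X x → A X′ x ⊎ x ≡ z) → (∀ {x} → A X′ x → A X x) →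
    (∀ {x} → B X x → B X′ x) → (∀ {x} → B X′ x → B X x) →
    ∀ {u} → A X′ u → Ĝ u z ≡ true → (∀ {i} → A X′ i → Ĝ i z ≡ true → u ≡ i ⊎ Good i z) → Good u z
  isolate-drop X X′ SX SX′ z Az ¬A′z A⊆ ⊆A B⊆ ⊆B {u} A′u uz∈Ĝ good =
    isolate Ĝ Ĝ-sym (lab X) (lab X′) SX SX′ (A X′) (_≡ z) uz∈Ĝ
      (lab-same X (inj₂ (inj₁ (⊆A A′u , Az))))
      (separated ∘ lab-reflect X′ u z)
      (λ i j eq → lab-same X (coarser (lab-reflect X′ i j eq)))
      (λ i j eq → joined (lab-reflect X i j eq))
      λ { i .z A′i refl iz∈Ĝ → case good A′i iz∈Ĝ of λ { (inj₁ u≡i) → inj₁ (u≡i , refl) ; (inj₂ G) → inj₂ G } }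
    where
    separated : ¬ Same X′ u z
    separated (inj₁ refl)             = ¬A′z A′u
    separated (inj₂ (inj₁ (_ , A′z))) = ¬A′z A′z
    separated (inj₂ (inj₂ (_ , B′z))) = disjoint X Az (⊆B B′z)
    coarser : ∀ {i j} → Same X′ i j → Same X i j
    coarser (inj₁ i≡j)               = inj₁ i≡j
    coarser (inj₂ (inj₁ (A′i , A′j))) = inj₂ (inj₁ (⊆A A′i , ⊆A A′j))
    coarser (inj₂ (inj₂ (B′i , B′j))) = inj₂ (inj₂ (⊆B B′i , ⊆B B′j))
    joined : ∀ {i j} → Same X i j → lab X′ i ≡ lab X′ j ⊎ (A X′ i × j ≡ z) ⊎ (i ≡ z × A X′ j)
    joined (inj₁ refl) = inj₁ refl
    joined (inj₂ (inj₂ (Bi , Bj))) = inj₁ (lab-same X′ (inj₂ (inj₂ (B⊆ Bi , B⊆ Bj))))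
    joined (inj₂ (inj₁ (Ai , Aj))) with A⊆ Ai | A⊆ Aj
    ... | inj₁ A′i  | inj₁ A′j  = inj₁ (lab-same X′ (inj₂ (inj₁ (A′i , A′j))))
    ... | inj₁ A′i  | inj₂ j≡z  = inj₂ (inj₁ (A′i , j≡z))
    ... | inj₂ i≡z  | inj₁ A′j  = inj₂ (inj₂ (i≡z , A′j))
    ... | inj₂ refl | inj₂ refl = inj₁ refl

  -- Here the only nontrivial block of `X` splits into the two blocks of `X′`, so the newly cut
  -- edges are those running between them.
  isolate-merge : (X X′ : Blocks E) → S (lab X) → S (lab X′) →
    (∀ {x} → ¬ B X x) → (∀ {x} → A X x → A X′ x ⊎ B X′ x) →
    (∀ {x} → A X′ x → A X x) → (∀ {x} → B X′ x → A X x) →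
    ∀ {u v} → A X′ u → B X′ v → Ĝ u v ≡ true →
    (∀ {i j} → A X′ i → B X′ j → Ĝ i j ≡ true → (u ≡ i × v ≡ j) ⊎ Good i j) → Good u v
  isolate-merge X X′ SX SX′ ¬B A⊆ A′⊆ B′⊆ {u} {v} A′u B′v uv∈Ĝ good =
    isolate Ĝ Ĝ-sym (lab X) (lab X′) SX SX′ (A X′) (B X′) uv∈Ĝ
      (lab-same X (inj₂ (inj₁ (A′⊆ A′u , B′⊆ B′v))))
      (separated ∘ lab-reflect X′ u v)
      (λ i j eq → lab-same X (coarser (lab-reflect X′ i j eq)))
      (λ i j eq → joined (lab-reflect X i j eq))
      (λ i j A′i B′j → good A′i B′j)
    where
    separated : ¬ Same X′ u v
    separated (inj₁ refl)             = disjoint X′ A′u B′v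
    separated (inj₂ (inj₁ (_ , A′v))) = disjoint X′ A′v B′v
    separated (inj₂ (inj₂ (B′u , _))) = disjoint X′ A′u B′u
    coarser : ∀ {i j} → Same X′ i j → Same X i j
    coarser (inj₁ i≡j)                = inj₁ i≡j
    coarser (inj₂ (inj₁ (A′i , A′j))) = inj₂ (inj₁ (A′⊆ A′i , A′⊆ A′j))
    coarser (inj₂ (inj₂ (B′i , B′j))) = inj₂ (inj₁ (B′⊆ B′i , B′⊆ B′j))
    joined : ∀ {i j} → Same X i j → lab X′ i ≡ lab X′ j ⊎ (A X′ i × B X′ j) ⊎ (B X′ i × A X′ j)
    joined (inj₁ refl) = inj₁ refl
    joined (inj₂ (inj₂ (Bi , _))) = contradiction Bi ¬B
    joined (inj₂ (inj₁ (Ai , Aj))) with A⊆ Ai | A⊆ Aj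
    ... | inj₁ A′i | inj₁ A′j = inj₁ (lab-same X′ (inj₂ (inj₁ (A′i , A′j))))
    ... | inj₁ A′i | inj₂ B′j = inj₂ (inj₁ (A′i , B′j))
    ... | inj₂ B′i | inj₁ A′j = inj₂ (inj₂ (B′i , A′j))
    ... | inj₂ B′i | inj₂ B′j = inj₁ (lab-same X′ (inj₂ (inj₂ (B′i , B′j))))

-- Closed paths

Linear-coordinate : ∀ {n} (u v : Fin n) → Linear (λ x → x u v)
Linear-coordinate u v c x rel = rel u v

Linear-+ : ∀ {n} {H H′ : Point n → ℚ} → Linear H → Linear H′ → Linear (λ x → H x + H′ x)
Linear-+ {H = H} {H′} lin lin′ {k} c x rel = begin
  ∑ (λ t → c t * (H (x t) + H′ (x t)))               ≡⟨ ∑-cong {k} (λ t → ℚ.*-distribˡ-+ (c t) (H (x t)) (H′ (x t))) ⟩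
  ∑ (λ t → c t * H (x t) + c t * H′ (x t))           ≡⟨ ∑-+ {k} _ _ ⟩
  ∑ (λ t → c t * H (x t)) + ∑ (λ t → c t * H′ (x t)) ≡⟨ cong₂ _+_ (lin c x rel) (lin′ c x rel) ⟩
  0ℚ                                                 ∎
  where open ≡-Reasoning

Linear-neg : ∀ {n} {H : Point n → ℚ} → Linear H → Linear (λ x → - H x)
Linear-neg {H = H} lin {k} c x rel = begin
  ∑ (λ t → c t * - H (x t))            ≡⟨ ∑-cong {k} (λ t → solve 2 (λ c h → c :* (:- h) := con (- 1ℚ) :* (c :* h)) refl (c t) (H (x t))) ⟩
  ∑ (λ t → - 1ℚ * (c t * H (x t)))     ≡⟨ ∑-*ˡ {k} (- 1ℚ) _ ⟩
  - 1ℚ * ∑ (λ t → c t * H (x t))       ≡⟨ cong (- 1ℚ *_) (lin c x rel) ⟩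
  0ℚ                                   ∎
  where open ≡-Reasoning ; open +-*-Solver

Linear-- : ∀ {n} {H H′ : Point n → ℚ} → Linear H → Linear H′ → Linear (λ x → H x - H′ x)
Linear-- {H = H} {H′} lin lin′ = Linear-+ {H = H} {λ x → - H′ x} lin (Linear-neg {H = H′} lin′)

psum : (ℕ → ℚ) → ℕ → ℚ
psum f zero    = 0ℚ
psum f (suc k) = psum f k + f k

psum-constant : ∀ f {a b} → a ℕ.≤ b → (∀ t → a ℕ.≤ t → t ℕ.< b → f t ≡ 0ℚ) → psum f b ≡ psum f a
psum-constant f {a} {b} a≤b f≗0 = subst (λ b → (∀ t → a ℕ.≤ t → t ℕ.< b → f t ≡ 0ℚ) → psum f b ≡ psum f a)
  (ℕ.m∸n+n≡m a≤b) (go (b ℕ.∸ a)) f≗0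
  where
  go : ∀ k → (∀ t → a ℕ.≤ t → t ℕ.< k ℕ.+ a → f t ≡ 0ℚ) → psum f (k ℕ.+ a) ≡ psum f a
  go zero    f≗0 = refl
  go (suc k) f≗0 = trans (cong₂ _+_ (go k λ t a≤t t< → f≗0 t a≤t (ℕ.m<n⇒m<1+n t<)) (f≗0 (k ℕ.+ a) (ℕ.m≤n+m a k) ℕ.≤-refl))
    (ℚ.+-identityʳ (psum f a))

module _ {n : ℕ} (ℓ : Labelling n) where

  -- The cut pseudometric on all pairs of nodes. Unlike `χ`, which is set to 0 off `Ĝ`, it satisfies
  -- the triangle inequality everywhere.
  dist : Fin n → Fin n → ℚ
  dist x y = if ⌊ ℓ x ≟ ℓ y ⌋ then 0ℚ else 1ℚ

  dist-refl : ∀ x → dist x x ≡ 0ℚ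
  dist-refl x with ℓ x ≟ ℓ x
  ... | yes _ = refl
  ... | no ne = contradiction refl ne

  dist-triangle : ∀ x y z → dist x z ≤ dist x y + dist y z
  dist-triangle x y z with ℓ x ≟ ℓ z | ℓ x ≟ ℓ y | ℓ y ≟ ℓ z
  ... | yes _ | yes _ | yes _ = from-yes (0ℚ ≤? 0ℚ + 0ℚ)
  ... | yes _ | yes _ | no _  = from-yes (0ℚ ≤? 0ℚ + 1ℚ)
  ... | yes _ | no _  | yes _ = from-yes (0ℚ ≤? 1ℚ + 0ℚ)
  ... | yes _ | no _  | no _  = from-yes (0ℚ ≤? 1ℚ + 1ℚ)
  ... | no _  | no _  | yes _ = from-yes (1ℚ ≤? 1ℚ + 0ℚ)
  ... | no _  | yes _ | no _  = from-yes (1ℚ ≤? 0ℚ + 1ℚ)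
  ... | no _  | no _  | no _  = from-yes (1ℚ ≤? 1ℚ + 1ℚ)
  ... | no ne | yes p | yes q = contradiction (trans p q) ne

-- A path p 0, …, p r of G whose end points are joined by an edge of Ĝ; values of p beyond r are irrelevant.
record ClosedPath {n : ℕ} (E Ĝ : Graph n) : Set where
  field
    E-sym    : ∀ i j → E i j ≡ E j i
    Ĝ-sym    : ∀ i j → Ĝ i j ≡ Ĝ j i
    Ĝ-irrefl : ∀ i → Ĝ i i ≡ false
    E⊆Ĝ      : ∀ {i j} → E i j ≡ true → Ĝ i j ≡ true
    r        : ℕ
    2≤r      : 2 ℕ.≤ r
    p        : ℕ → Fin n
    p-inj    : ∀ {s t} → s ℕ.≤ r → t ℕ.≤ r → p s ≡ p t → s ≡ t
    p-edge   : ∀ {t} → t ℕ.< r → E (p t) (p (suc t)) ≡ true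
    p-close  : Ĝ (p 0) (p r) ≡ true

  len : Point n → ℕ → ℚ
  len x = psum (λ t → x (p t) (p (suc t)))

  NoChord : Set
  NoChord = ∀ {s t} → s ℕ.< t → t ℕ.≤ r → Ĝ (p s) (p t) ≡ true → t ≡ suc s ⊎ (s ≡ 0 × t ≡ r)

  Seg : ℕ → ℕ → Fin n → Set
  Seg lo hi x = ∃ λ t → lo ℕ.≤ t × t ℕ.≤ hi × p t ≡ x

  Seg? : ∀ lo hi x → Dec (Seg lo hi x)
  Seg? lo hi x = map′
    (λ { (t , lo≤t , eq) → toℕ t , lo≤t , ℕ.s≤s⁻¹ (Fin.toℕ<n t) , eq })
    (λ { (t , lo≤t , t≤hi , refl) → fromℕ< (s≤s t≤hi) ,
         subst (λ z → lo ℕ.≤ z × p z ≡ p t) (sym (Fin.toℕ-fromℕ< (s≤s t≤hi))) (lo≤t , refl) })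
    (Fin.any? {n = suc hi} λ t → (lo ℕ.≤? toℕ t) ×-dec (p (toℕ t) ≟ x))

  seg-index : ∀ {lo hi t} → hi ℕ.≤ r → t ℕ.≤ r → Seg lo hi (p t) → lo ℕ.≤ t × t ℕ.≤ hi
  seg-index hi≤r t≤r (s , lo≤s , s≤hi , eq) with p-inj (ℕ.≤-trans s≤hi hi≤r) t≤r eq
  ... | refl = lo≤s , s≤hi

  seg-disjoint : ∀ {lo hi lo′ hi′} → hi ℕ.≤ r → hi′ ℕ.≤ r → hi ℕ.< lo′ ⊎ hi′ ℕ.< lo →
    ∀ {x} → Seg lo hi x → ¬ Seg lo′ hi′ x
  seg-disjoint hi≤r hi′≤r apart (t , lo≤t , t≤hi , refl) in′
    with seg-index hi′≤r (ℕ.≤-trans t≤hi hi≤r) in′ | apart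
  ... | lo′≤t , _    | inj₁ hi<lo′ = ℕ.<⇒≱ hi<lo′ (ℕ.≤-trans lo′≤t t≤hi)
  ... | _    , t≤hi′ | inj₂ hi′<lo = ℕ.<⇒≱ hi′<lo (ℕ.≤-trans lo≤t t≤hi′)

  seg-reach : ∀ {lo hi} → hi ℕ.≤ r → (T : Fin n → Set) → (∀ x → Seg lo hi x → T x) →
    ∀ {x} → Seg lo hi x → Reach E T x (p lo)
  seg-reach {lo} {hi} hi≤r T ⊆T (t , lo≤t , t≤hi , refl) = go t lo≤t t≤hi
    where
    go : ∀ t → lo ℕ.≤ t → t ℕ.≤ hi → Reach E T (p t) (p lo)
    go t lo≤t t≤hi with ℕ.m≤n⇒m<n∨m≡n lo≤t
    ... | inj₂ refl = here (⊆T _ (t , lo≤t , t≤hi , refl))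
    go (suc t) lo≤t t<hi | inj₁ lo<t = step (⊆T _ (suc t , lo≤t , t<hi , refl))
      (trans (E-sym _ _) (p-edge (ℕ.<-≤-trans t<hi hi≤r))) (go t (ℕ.s≤s⁻¹ lo<t) (ℕ.<⇒≤ t<hi))

  -- Either segment may come first on the path, because the block that loses a node has to be `A`,
  -- wherever it lies. Bounds with `hi′ < lo′` make the second block empty.
  twoSegments : ∀ lo hi lo′ hi′ → hi ℕ.≤ r → hi′ ℕ.≤ r → hi ℕ.< lo′ ⊎ hi′ ℕ.< lo → Blocks E
  twoSegments lo hi lo′ hi′ hi≤r hi′≤r apart = record
    { A = Seg lo hi ; B = Seg lo′ hi′ ; A? = Seg? lo hi ; B? = Seg? lo′ hi′
    ; disjoint = seg-disjoint hi≤r hi′≤r apart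
    ; a = p lo ; b = p lo′
    ; to-a = seg-reach hi≤r (Seg lo hi) (λ _ s → s) ; to-b = seg-reach hi′≤r (Seg lo′ hi′) (λ _ s → s) }

  -- The path cut on both sides of its inner node p (suc k).
  isolating : ∀ k → suc k ℕ.< r → Blocks E
  isolating k k<r = twoSegments (suc (suc k)) r 0 k ℕ.≤-refl (ℕ.<⇒≤ (ℕ.<⇒≤ k<r)) (inj₂ (ℕ.n≤1+n (suc k)))

  module _ (ℓ : Labelling n) where

    χ-dist : ∀ {i j} → Ĝ i j ≡ true → χ Ĝ ℓ i j ≡ dist ℓ i j
    χ-dist e rewrite e = refl

    -- The triangle inequality iterated along the subpath; the length of the prefix stands on the
    -- left to keep subtraction out of the induction.
    dist≤len : ∀ {a b} → a ℕ.≤ b → b ℕ.≤ r → dist ℓ (p a) (p b) + len (χ Ĝ ℓ) a ≤ len (χ Ĝ ℓ) b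
    dist≤len {a} {b} a≤b b≤r = subst (λ b → b ℕ.≤ r → dist ℓ (p a) (p b) + len (χ Ĝ ℓ) a ≤ len (χ Ĝ ℓ) b)
      (ℕ.m∸n+n≡m a≤b) (go (b ℕ.∸ a)) b≤r
      where
      open +-*-Solver
      L = len (χ Ĝ ℓ)
      go : ∀ k → k ℕ.+ a ℕ.≤ r → dist ℓ (p a) (p (k ℕ.+ a)) + L a ≤ L (k ℕ.+ a)
      go zero    _   = ℚ.≤-reflexive (trans (cong (_+ L a) (dist-refl ℓ (p a))) (ℚ.+-identityˡ (L a)))
      go (suc k) k<r = begin
        dist ℓ x z + L a                      ≤⟨ ℚ.+-monoˡ-≤ (L a) (dist-triangle ℓ x y z) ⟩
        dist ℓ x y + dist ℓ y z + L a         ≡⟨ solve 3 (λ a b c → a :+ b :+ c := a :+ c :+ b) refl (dist ℓ x y) (dist ℓ y z) (L a) ⟩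
        dist ℓ x y + L a + dist ℓ y z         ≤⟨ ℚ.+-monoˡ-≤ (dist ℓ y z) (go k (ℕ.<⇒≤ k<r)) ⟩
        L (k ℕ.+ a) + dist ℓ y z              ≡⟨ cong (L (k ℕ.+ a) +_) (χ-dist (E⊆Ĝ (p-edge k<r))) ⟨
        L (suc k ℕ.+ a)                       ∎
        where
        open ℚ.≤-Reasoning
        x = p a
        y = p (k ℕ.+ a)
        z = p (suc k ℕ.+ a)

    valid : χ Ĝ ℓ (p 0) (p r) ≤ len (χ Ĝ ℓ) r
    valid = begin
      χ Ĝ ℓ (p 0) (p r)          ≡⟨ χ-dist p-close ⟩
      dist ℓ (p 0) (p r)         ≡⟨ ℚ.+-identityʳ _ ⟨
      dist ℓ (p 0) (p r) + 0ℚ    ≤⟨ dist≤len z≤n ℕ.≤-refl ⟩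
      len (χ Ĝ ℓ) r              ∎
      where open ℚ.≤-Reasoning

    -- A tight path admits no shortcut: the detour through the chord is at least
    -- `dist ℓ (p 0) (p r)`, which is the length of the whole path, so the chord is as long as its
    -- subpath.
    tight-subpath : χ Ĝ ℓ (p 0) (p r) ≡ len (χ Ĝ ℓ) r → ∀ {a b} → a ℕ.≤ b → b ℕ.≤ r → Ĝ (p a) (p b) ≡ true →
      χ Ĝ ℓ (p a) (p b) ≡ len (χ Ĝ ℓ) b - len (χ Ĝ ℓ) a
    tight-subpath tight {a} {b} a≤b b≤r ab∈Ĝ = trans (χ-dist ab∈Ĝ) (ℚ.≤-antisym upper lower)
      where
      open ℚ.≤-Reasoning
      open +-*-Solver
      L = len (χ Ĝ ℓ)
      x = p 0
      y = p a
      z = p b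
      w = p r
      upper : dist ℓ y z ≤ L b - L a
      upper = begin
        dist ℓ y z                ≡⟨ solve 2 (λ d l → d := d :+ l :- l) refl (dist ℓ y z) (L a) ⟩
        dist ℓ y z + L a - L a    ≤⟨ ℚ.+-monoˡ-≤ (- L a) (dist≤len a≤b b≤r) ⟩
        L b - L a                 ∎
      whole : L r ≤ (L a + dist ℓ y z) + (L r - L b)
      whole = begin
        L r                                                 ≡⟨ trans (sym tight) (χ-dist p-close) ⟩
        dist ℓ x w                                          ≤⟨ dist-triangle ℓ x z w ⟩
        dist ℓ x z + dist ℓ z w                             ≤⟨ ℚ.+-monoˡ-≤ (dist ℓ z w) (dist-triangle ℓ x y z) ⟩
        dist ℓ x y + dist ℓ y z + dist ℓ z w                ≡⟨ solve 4 (λ a b c l → a :+ b :+ c := (a :+ con 0ℚ :+ b) :+ (c :+ l :- l)) refl (dist ℓ x y) (dist ℓ y z) (dist ℓ z w) (L b) ⟩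
        (dist ℓ x y + 0ℚ + dist ℓ y z) + (dist ℓ z w + L b - L b)
          ≤⟨ ℚ.+-mono-≤ (ℚ.+-monoˡ-≤ (dist ℓ y z) (dist≤len z≤n (ℕ.≤-trans a≤b b≤r))) (ℚ.+-monoˡ-≤ (- L b) (dist≤len b≤r ℕ.≤-refl)) ⟩
        (L a + dist ℓ y z) + (L r - L b)                    ∎
      lower : L b - L a ≤ dist ℓ y z
      lower = begin
        L b - L a                                              ≡⟨ solve 3 (λ r b a → b :- a := r :+ (b :- r :- a)) refl (L r) (L b) (L a) ⟩
        L r + (L b - L r - L a)                                ≤⟨ ℚ.+-monoˡ-≤ (L b - L r - L a) whole ⟩
        (L a + dist ℓ y z) + (L r - L b) + (L b - L r - L a)   ≡⟨ solve 4 (λ a d r b → (a :+ d) :+ (r :- b) :+ (b :- r :- a) := d) refl (L a) (dist ℓ y z) (L r) (L b) ⟩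
        dist ℓ y z                                             ∎

    tight-whole : (∀ {t} → t ℕ.≤ r → ℓ (p t) ≡ ℓ (p 0)) → χ Ĝ ℓ (p 0) (p r) ≡ len (χ Ĝ ℓ) r
    tight-whole same = trans (χ-same Ĝ ℓ (sym (same ℕ.≤-refl)))
      (sym (psum-constant _ z≤n λ t _ t<r → χ-same Ĝ ℓ (trans (same (ℕ.<⇒≤ t<r)) (sym (same t<r)))))

    tight-cut : ∀ {j} → j ℕ.< r → (∀ {t} → t ℕ.≤ j → ℓ (p t) ≡ ℓ (p 0)) →
      (∀ {t} → j ℕ.< t → t ℕ.≤ r → ℓ (p t) ≡ ℓ (p r)) → ℓ (p 0) ≢ ℓ (p r) →
      χ Ĝ ℓ (p 0) (p r) ≡ len (χ Ĝ ℓ) r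
    tight-cut {j} j<r low high ne = trans (χ-diff Ĝ ℓ p-close ne) (sym (begin
      len (χ Ĝ ℓ) r         ≡⟨ psum-constant f j<r (λ t j<t t<r → χ-same Ĝ ℓ (trans (high j<t (ℕ.<⇒≤ t<r)) (sym (high (ℕ.m<n⇒m<1+n j<t) t<r)))) ⟩
      psum f j + f j        ≡⟨ cong₂ _+_ (psum-constant f z≤n (λ t _ t<j → χ-same Ĝ ℓ (trans (low (ℕ.<⇒≤ t<j)) (sym (low t<j)))))
                                 (χ-diff Ĝ ℓ (E⊆Ĝ (p-edge j<r)) λ eq → ne (trans (sym (low ℕ.≤-refl)) (trans eq (high ℕ.≤-refl j<r)))) ⟩
      0ℚ + 1ℚ               ≡⟨⟩
      1ℚ                    ∎))
      where
      open ≡-Reasoning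
      f = λ t → χ Ĝ ℓ (p t) (p (suc t))

  module _ (k : ℕ) (k<r : suc k ℕ.< r) where
    open Blocks (isolating k k<r) using (lab; lab-same; lab-reflect)

    private
      k≤r : k ℕ.≤ r
      k≤r = ℕ.<⇒≤ (ℕ.<⇒≤ k<r)

    isolating-separates : ∀ {s t} → s ℕ.< t → t ℕ.≤ r → s ℕ.≤ suc k → suc k ℕ.≤ t → lab (p s) ≢ lab (p t)
    isolating-separates {s} {t} s<t t≤r s≤ t≥ eq with lab-reflect (p s) (p t) eq
    ... | inj₁ ps≡pt = ℕ.<⇒≢ s<t (p-inj (ℕ.≤-trans (ℕ.<⇒≤ s<t) t≤r) t≤r ps≡pt)
    ... | inj₂ (inj₁ (As , _)) = ℕ.<⇒≱ (s≤s s≤) (proj₁ (seg-index ℕ.≤-refl (ℕ.≤-trans (ℕ.<⇒≤ s<t) t≤r) As))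
    ... | inj₂ (inj₂ (_ , Bt)) = ℕ.<⇒≱ t≥ (proj₂ (seg-index k≤r t≤r Bt))

    private
      f : ℕ → ℚ
      f t = χ Ĝ lab (p t) (p (suc t))

    len-isolating-before : ∀ {a} → a ℕ.≤ k → len (χ Ĝ lab) a ≡ 0ℚ
    len-isolating-before a≤k = psum-constant f z≤n λ t _ t<a →
      χ-same Ĝ lab (lab-same (inj₂ (inj₂ ((t , z≤n , ℕ.<⇒≤ (ℕ.<-≤-trans t<a a≤k) , refl) , (suc t , z≤n , ℕ.≤-trans t<a a≤k , refl)))))

    len-isolating-at : len (χ Ĝ lab) (suc k) ≡ 1ℚ
    len-isolating-at = cong₂ _+_ (len-isolating-before ℕ.≤-refl)
      (χ-diff Ĝ lab (E⊆Ĝ (p-edge (ℕ.<⇒≤ k<r))) (isolating-separates ℕ.≤-refl (ℕ.<⇒≤ k<r) (ℕ.n≤1+n k) ℕ.≤-refl))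

    len-isolating-after : ∀ {b} → suc k ℕ.< b → b ℕ.≤ r → len (χ Ĝ lab) b ≡ 1ℚ + 1ℚ
    len-isolating-after {b} k<b b≤r = trans
      (psum-constant f k<b λ t k<t t<b → χ-same Ĝ lab (lab-same (inj₂ (inj₁
        ((t , k<t , ℕ.≤-trans (ℕ.<⇒≤ t<b) b≤r , refl) , (suc t , ℕ.m<n⇒m<1+n k<t , ℕ.≤-trans t<b b≤r , refl))))))
      (cong₂ _+_ len-isolating-at (χ-diff Ĝ lab (E⊆Ĝ (p-edge k<r)) (isolating-separates ℕ.≤-refl k<r ℕ.≤-refl (ℕ.n≤1+n (suc k)))))

  defect : Point n → ℚ
  defect x = x (p 0) (p r) - len x r

  subdefect : ℕ → ℕ → Point n → ℚ
  subdefect a b x = x (p a) (p b) - (len x b - len x a)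

  len-linear : ∀ k → Linear (λ x → len x k)
  len-linear zero    {m} c x rel = ∑-zero {m} λ t → ℚ.*-zeroʳ (c t)
  len-linear (suc k) = Linear-+ {H = λ x → len x k} {λ x → x (p k) (p (suc k))} (len-linear k) (Linear-coordinate _ _)

  defect-linear : Linear defect
  defect-linear = Linear-- {H = λ x → x (p 0) (p r)} {λ x → len x r} (Linear-coordinate _ _) (len-linear r)

  subdefect-linear : ∀ a b → Linear (subdefect a b)
  subdefect-linear a b = Linear-- {H = λ x → x (p a) (p b)} {λ x → len x b - len x a} (Linear-coordinate _ _)
    (Linear-- {H = λ x → len x b} {λ x → len x a} (len-linear b) (len-linear a))

  -- The end nodes are separated while two path edges are cut, so the value is `1 - 2`.
  defect-isolating : ∀ k (k<r : suc k ℕ.< r) → defect (χ Ĝ (Blocks.lab (isolating k k<r))) ≢ 0ℚ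
  defect-isolating k k<r eq with trans (sym eq) (cong₂ _-_
    (χ-diff Ĝ (Blocks.lab (isolating k k<r)) p-close (isolating-separates k k<r (ℕ.<-≤-trans (s≤s z≤n) k<r) ℕ.≤-refl z≤n (ℕ.<⇒≤ k<r)))
    (len-isolating-after k k<r k<r ℕ.≤-refl))
  ... | ()

  -- The witness p (suc k) is an end of the chord that is an inner node of the path.
  chord-inner-end : ∀ {a b} → a ℕ.< b → b ℕ.≤ r → Ĝ (p a) (p b) ≡ true → ¬ (a ≡ 0 × b ≡ r) →
    ∃ λ k → Σ (suc k ℕ.< r) λ k<r → subdefect a b (χ Ĝ (Blocks.lab (isolating k k<r))) ≡ 0ℚ
  chord-inner-end {suc k} a<b b≤r ab∈Ĝ _ = k , k<r , cong₂ _-_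
    (χ-diff Ĝ (Blocks.lab (isolating k k<r)) ab∈Ĝ (isolating-separates k k<r a<b b≤r ℕ.≤-refl (ℕ.<⇒≤ a<b)))
    (cong₂ _-_ (len-isolating-after k k<r a<b b≤r) (len-isolating-at k k<r))
    where k<r = ℕ.<-≤-trans a<b b≤r
  chord-inner-end {zero} {suc k} a<b b≤r ab∈Ĝ ≢close = k , k<r , cong₂ _-_
    (χ-diff Ĝ (Blocks.lab (isolating k k<r)) ab∈Ĝ (isolating-separates k k<r a<b b≤r z≤n ℕ.≤-refl))
    (cong (_- 0ℚ) (len-isolating-at k k<r))
    where k<r = ℕ.≤∧≢⇒< b≤r (λ b≡r → ≢close (refl , b≡r))

  x-x≡0 : ∀ {x y : ℚ} → x ≡ y → x - y ≡ 0ℚ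
  x-x≡0 {x} refl = ℚ.+-inverseʳ x

  module _ {lhs rhs : Point n → ℚ}
    (lhs≡ : ∀ ℓ → lhs (χ Ĝ ℓ) ≡ χ Ĝ ℓ (p 0) (p r)) (rhs≡ : ∀ ℓ → rhs (χ Ĝ ℓ) ≡ len (χ Ĝ ℓ) r) where

    face-tight : ∀ {ℓ} → lhs (χ Ĝ ℓ) ≡ rhs (χ Ĝ ℓ) → χ Ĝ ℓ (p 0) (p r) ≡ len (χ Ĝ ℓ) r
    face-tight {ℓ} eq = trans (sym (lhs≡ ℓ)) (trans eq (rhs≡ ℓ))

    -- Isolating an inner end of the chord cuts one edge of its subpath and the chord, so only the
    -- equation of the whole path fails. Isolating `p (suc a)`, strictly inside the subpath as `b`
    -- is not `suc a`, cuts two edges there and breaks the equation of the chord.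
    chord⇒¬facet : ∀ {a b} → a ℕ.< b → b ℕ.≤ r → Ĝ (p a) (p b) ≡ true → b ≢ suc a → ¬ (a ≡ 0 × b ≡ r) →
      ¬ DefinesFacet E Ĝ lhs rhs
    chord⇒¬facet {a} {b} a<b b≤r ab∈Ĝ b≢1+a ≢close =
      case chord-inner-end a<b b≤r ab∈Ĝ ≢close of λ { (k , k<r , sub≡0) →
        two-equations⇒¬facet Ĝ E lhs rhs defect (subdefect a b) defect-linear (subdefect-linear a b)
          (λ ℓ fℓ → x-x≡0 (face-tight (proj₂ fℓ)))
          (λ ℓ fℓ → x-x≡0 (tight-subpath ℓ (face-tight (proj₂ fℓ)) (ℕ.<⇒≤ a<b) b≤r ab∈Ĝ))
          (Blocks.lab (isolating k k<r)) (Blocks.lab (isolating a 1+a<r))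
          (Blocks.lab-decomposition (isolating k k<r) E-sym) (Blocks.lab-decomposition (isolating a 1+a<r) E-sym)
          (defect-isolating k k<r) sub≡0 sub≢0 }
      where
      1+a<b : suc a ℕ.< b
      1+a<b = ℕ.≤∧≢⇒< a<b (b≢1+a ∘ sym)
      1+a<r : suc a ℕ.< r
      1+a<r = ℕ.<-≤-trans 1+a<b b≤r
      sub≢0 : subdefect a b (χ Ĝ (Blocks.lab (isolating a 1+a<r))) ≢ 0ℚ
      sub≢0 eq with trans (sym eq) (cong₂ _-_
        (χ-diff Ĝ (Blocks.lab (isolating a 1+a<r)) ab∈Ĝ (isolating-separates a 1+a<r a<b b≤r (ℕ.n≤1+n a) a<b))
        (cong₂ _-_ (len-isolating-after a 1+a<r 1+a<b b≤r) (len-isolating-before a 1+a<r ℕ.≤-refl)))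
      ... | ()

-- The facet

least : (Q : ℕ → Set) → (∀ d → Dec (Q d)) → ∀ N → Q N → ∃ λ m → Q m × (∀ {d} → Q d → m ℕ.≤ d)
least Q Q? zero    QN = zero , QN , λ _ → z≤n
least Q Q? (suc N) QN with Q? zero
... | yes Q₀ = zero , Q₀ , λ _ → z≤n
... | no ¬Q₀ with least (Q ∘ suc) (Q? ∘ suc) N QN
...   | m , Qm , minimal = suc m , Qm , λ { {zero} Q₀ → contradiction Q₀ ¬Q₀ ; {suc d} Qd → s≤s (minimal Qd) }

record Forest {n : ℕ} (E : Graph n) (R : Fin n → Set) : Set where
  field
    dep      : Fin n → ℕ
    par      : Fin n → Fin n
    par-edge : ∀ {x} → ¬ R x → E x (par x) ≡ true
    par-dep  : ∀ {x} → ¬ R x → dep (par x) ℕ.< dep x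

-- The depth is the distance to `R`, and the parent is the next node on a shortest walk towards `R`.
forest : ∀ {n} {E : Graph n} → Connected E → (R : Fin n → Set) → (∀ x → Dec (R x)) → ∀ {ρ} → R ρ → Forest E R
forest {n} {E} conn R R? {ρ} Rρ = record { dep = dep ; par = proj₁ ∘ parent
  ; par-edge = λ {x} ¬Rx → proj₁ (proj₂ (parent x) ¬Rx) ; par-dep = λ {x} ¬Rx → proj₂ (proj₂ (parent x) ¬Rx) }
  where
  Within : ℕ → Fin n → Set
  Within zero    x = R x
  Within (suc d) x = R x ⊎ ∃ λ y → E x y ≡ true × Within d y
  within? : ∀ d x → Dec (Within d x)
  within? zero    x = R? x
  within? (suc d) x = R? x ⊎-dec Fin.any? λ y → (E x y Bool.≟ true) ×-dec within? d y
  reach-within : ∀ {x y} → Reach E (λ _ → ⊤) x y → R y → ∃ λ d → Within d x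
  reach-within (here _)     Ry = zero , Ry
  reach-within (step _ e r) Ry with reach-within r Ry
  ... | d , within = suc d , inj₂ (_ , e , within)
  distance : ∀ x → ∃ λ m → Within m x × (∀ {d} → Within d x → m ℕ.≤ d)
  distance x = uncurry (least (λ d → Within d x) (λ d → within? d x)) (reach-within (conn x ρ) Rρ)
  dep : Fin n → ℕ
  dep x = proj₁ (distance x)
  parent : ∀ x → ∃ λ y → ¬ R x → E x y ≡ true × dep y ℕ.< dep x
  parent x with distance x
  -- Nodes of `R` get themselves as parent, a default that the hypothesis `¬ R x` screens off.
  ... | zero  , Rx , _                  = x , λ ¬Rx → contradiction Rx ¬Rx
  ... | suc d , inj₁ Rx , _             = x , λ ¬Rx → contradiction Rx ¬Rx
  ... | suc d , inj₂ (y , e , withy) , _ = y , λ _ → e , s≤s (proj₂ (proj₂ (distance y)) withy)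

-- Branches of the spanning forest and the vectors they yield

module _ {n : ℕ} {E Ĝ : Graph n} (C : ClosedPath E Ĝ) (conn : Connected E) where
  open ClosedPath C
  open Blocks

  OnP : Fin n → Set
  OnP = Seg 0 r

  onP : ∀ {t} → t ℕ.≤ r → OnP (p t)
  onP t≤r = _ , z≤n , t≤r , refl

  open Forest (forest conn OnP (Seg? 0 r) (onP z≤n))

  -- Reflexive ancestry restricted to nodes off the path. If `par u` lies on the path, it has no
  -- ancestors in this sense, and the branch of `u` is just `u`.
  data Anc : Fin n → Fin n → Set where
    self : ∀ {x} → ¬ OnP x → Anc x x
    up   : ∀ {x z} → ¬ OnP x → Anc (par x) z → Anc x z

  data Root : Fin n → ℕ → Set where
    stop : ∀ {i} → i ℕ.≤ r → Root (p i) i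
    up   : ∀ {x i} → ¬ OnP x → Root (par x) i → Root x i

  Anc? : ∀ u x → Dec (Anc u x)
  Anc? u x = go u (<-wellFounded (dep u))
    where
    go : ∀ u → Acc ℕ._<_ (dep u) → Dec (Anc u x)
    go u (acc rs) with Seg? 0 r u
    ... | yes Pu = no λ { (self ¬Pu) → ¬Pu Pu ; (up ¬Pu _) → ¬Pu Pu }
    ... | no ¬Pu with u ≟ x
    ...   | yes refl = yes (self ¬Pu)
    ...   | no u≢x = map′ (up ¬Pu) (λ { (self _) → contradiction refl u≢x ; (up _ a) → a }) (go (par u) (rs (par-dep ¬Pu)))

  root : ∀ u → ∃ (Root u)
  root u = go u (<-wellFounded (dep u))
    where
    go : ∀ u → Acc ℕ._<_ (dep u) → ∃ (Root u)
    go u (acc rs) with Seg? 0 r u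
    ... | yes (i , _ , i≤r , refl) = i , stop i≤r
    ... | no ¬Pu with go (par u) (rs (par-dep ¬Pu))
    ...   | i , ρ = i , up ¬Pu ρ

  rootIx : Fin n → ℕ
  rootIx u = proj₁ (root u)

  Root≤r : ∀ {u i} → Root u i → i ℕ.≤ r
  Root≤r (stop i≤r) = i≤r
  Root≤r (up _ ρ)   = Root≤r ρ

  rootIx≤r : ∀ u → rootIx u ℕ.≤ r
  rootIx≤r u = Root≤r (proj₂ (root u))

  anc-off : ∀ {u x} → Anc u x → ¬ OnP x
  anc-off (self ¬P) = ¬P
  anc-off (up _ a)  = anc-off a

  anc-dep : ∀ {u x} → Anc u x → dep x ℕ.≤ dep u
  anc-dep (self _)  = ℕ.≤-refl
  anc-dep (up ¬P a) = ℕ.≤-trans (anc-dep a) (ℕ.<⇒≤ (par-dep ¬P))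

  anc-par-dep : ∀ {u x} → ¬ OnP u → Anc (par u) x → dep x ℕ.< dep u
  anc-par-dep ¬Pu a = ℕ.≤-<-trans (anc-dep a) (par-dep ¬Pu)

  ¬anc-par : ∀ {u} → ¬ OnP u → ¬ Anc (par u) u
  ¬anc-par ¬Pu a = ℕ.<-irrefl refl (anc-par-dep ¬Pu a)

  anc-split : ∀ {u x} → Anc u x → Anc (par u) x ⊎ x ≡ u
  anc-split (self _) = inj₂ refl
  anc-split (up _ a) = inj₁ a

  anc-trans : ∀ {u y z} → Anc u y → Anc y z → Anc u z
  anc-trans (self _)  b = b
  anc-trans (up ¬P a) b = up ¬P (anc-trans a b)

  anc-root : ∀ {u x i} → Anc u x → Root u i → Root x i
  anc-root (self _)  ρ          = ρ
  anc-root (up ¬P a) (stop i≤r) = contradiction (onP i≤r) ¬P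
  anc-root (up _ a)  (up _ ρ)   = anc-root a ρ

  reach-root : ∀ {x i} (T : Fin n → Set) → (∀ {y} → Anc x y → T y) → T (p i) → Root x i → Reach E T x (p i)
  reach-root T ⊆T Tpᵢ (stop _)  = here Tpᵢ
  reach-root T ⊆T Tpᵢ (up ¬P ρ) = step (⊆T (self ¬P)) (par-edge ¬P) (reach-root T (⊆T ∘ up ¬P) Tpᵢ ρ)

  reach-ancestor : ∀ {x z} (T : Fin n → Set) → (∀ {y} → Anc x y → Anc y z → T y) → Anc x z → Reach E T x z
  reach-ancestor T ⊆T (self ¬P) = here (⊆T (self ¬P) (self ¬P))
  reach-ancestor T ⊆T (up ¬P a) =
    step (⊆T (self ¬P) (up ¬P a)) (par-edge ¬P) (reach-ancestor T (⊆T ∘ up ¬P) a)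

  Branch : ℕ → ℕ → Fin n → Fin n → Fin n → Set
  Branch lo hi u v x = Seg lo hi x ⊎ Anc u x ⊎ Anc v x

  -- A branch is connected to the segment through its root, whose index must therefore lie within
  -- the bounds. Equal `u` and `v` give a single branch.
  branches : ∀ lo hi u v lo′ hi′ → hi ℕ.≤ r → hi′ ℕ.≤ r → hi ℕ.< lo′ ⊎ hi′ ℕ.< lo →
    lo ℕ.≤ rootIx u × rootIx u ℕ.≤ hi → lo ℕ.≤ rootIx v × rootIx v ℕ.≤ hi → Blocks E
  branches lo hi u v lo′ hi′ hi≤r hi′≤r apart u∈ v∈ = record
    { A = Branch lo hi u v ; B = Seg lo′ hi′
    ; A? = λ x → Seg? lo hi x ⊎-dec (Anc? u x ⊎-dec Anc? v x) ; B? = Seg? lo′ hi′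
    ; disjoint = λ { (inj₁ s) → seg-disjoint hi≤r hi′≤r apart s
                   ; (inj₂ (inj₁ a)) (t , _ , t≤hi′ , eq) → anc-off a (t , z≤n , ℕ.≤-trans t≤hi′ hi′≤r , eq)
                   ; (inj₂ (inj₂ a)) (t , _ , t≤hi′ , eq) → anc-off a (t , z≤n , ℕ.≤-trans t≤hi′ hi′≤r , eq) }
    ; a = p lo ; b = p lo′
    ; to-a = λ { (inj₁ s) → seg-to-lo s
               ; (inj₂ (inj₁ a)) → climb u u∈ (inj₂ ∘ inj₁) a
               ; (inj₂ (inj₂ a)) → climb v v∈ (inj₂ ∘ inj₂) a }
    ; to-b = seg-reach hi′≤r (Seg lo′ hi′) (λ _ s → s) }
    where
    seg-to-lo : ∀ {x} → Seg lo hi x → Reach E (Branch lo hi u v) x (p lo)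
    seg-to-lo = seg-reach hi≤r (Branch lo hi u v) (λ _ → inj₁)
    climb : ∀ w → lo ℕ.≤ rootIx w × rootIx w ℕ.≤ hi → (∀ {y} → Anc w y → Branch lo hi u v y) →
      ∀ {x} → Anc w x → Reach E (Branch lo hi u v) x (p lo)
    climb w (lo≤ , ≤hi) ⊆A a = reach-trans
      (reach-root (Branch lo hi u v) (⊆A ∘ anc-trans a) (inj₁ seg) (anc-root a (proj₂ (root w)))) (seg-to-lo seg)
      where seg = rootIx w , lo≤ , ≤hi , refl

  wholePath : Fin n → Fin n → Blocks E
  wholePath u v = branches 0 r u v (suc r) r ℕ.≤-refl ℕ.≤-refl (inj₁ ℕ.≤-refl)
    (z≤n , rootIx≤r u) (z≤n , rootIx≤r v)

  -- Ending the block at `z` rather than at the path keeps the edges from `u` to nodes above `z` out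
  -- of the comparison.
  ancestorInterval : ∀ u z → Blocks E
  ancestorInterval u z = record
    { A = λ y → Anc u y × Anc y z ; B = OnP
    ; A? = λ y → Anc? u y ×-dec Anc? y z ; B? = Seg? 0 r
    ; disjoint = λ { (a , _) → anc-off a }
    ; a = z ; b = p 0
    ; to-a = λ { (a , b) → reach-ancestor _ (λ c d → anc-trans a c , d) b }
    ; to-b = seg-reach ℕ.≤-refl OnP (λ _ s → s) }

  -- Of the face only its available shapes enter: the path within one block, or cut at one edge with
  -- either block holding the initial part. The last assumption adds `q`.
  module Spanning {S : Labelling n → Set} (no-chord : NoChord)
    (whole∈A : (X : Blocks E) → (∀ {t} → t ℕ.≤ r → A X (p t)) → S (lab X))
    (whole∈B : (X : Blocks E) → (∀ {t} → t ℕ.≤ r → B X (p t)) → S (lab X))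
    (cutAB : (X : Blocks E) → ∀ {j} → j ℕ.< r → (∀ {t} → t ℕ.≤ j → A X (p t)) → (∀ {t} → j ℕ.< t → t ℕ.≤ r → B X (p t)) → S (lab X))
    (cutBA : (X : Blocks E) → ∀ {j} → j ℕ.< r → (∀ {t} → t ℕ.≤ j → B X (p t)) → (∀ {t} → j ℕ.< t → t ℕ.≤ r → A X (p t)) → S (lab X))
    (q∈S : S (lab (isolating 0 2≤r))) where

    private
      G : Fin n → Fin n → Set
      G = Good {E = E} {Ĝ} Ĝ-sym {S}
      sym-G : ∀ {i j} → G i j → G j i
      sym-G = Good-sym {E = E} {Ĝ} Ĝ-sym {S}

    1≤r : 1 ℕ.≤ r
    1≤r = ℕ.<⇒≤ 2≤r

    seg-empty : ∀ {x} → ¬ Seg (suc r) r x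
    seg-empty (t , r<t , t≤r , _) = ℕ.<⇒≱ r<t t≤r

    seg-cases : ∀ k → k ℕ.< r → ∀ {x} → OnP x → Seg 0 k x ⊎ Seg (suc k) r x
    seg-cases k k<r (t , _ , t≤r , eq) with t ℕ.≤? k
    ... | yes t≤k = inj₁ (t , z≤n , t≤k , eq)
    ... | no t≰k  = inj₂ (t , ℕ.≰⇒> t≰k , t≤r , eq)

    seg⊆OnP : ∀ {lo hi} → hi ℕ.≤ r → ∀ {x} → Seg lo hi x → OnP x
    seg⊆OnP hi≤r (t , _ , t≤hi , eq) = t , z≤n , ℕ.≤-trans t≤hi hi≤r , eq

    pathBlock : Blocks E
    pathBlock = twoSegments 0 r (suc r) r ℕ.≤-refl ℕ.≤-refl (inj₁ ℕ.≤-refl)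

    splitBlocks : ∀ k → k ℕ.< r → Blocks E
    splitBlocks k k<r = twoSegments 0 k (suc k) r (ℕ.<⇒≤ k<r) ℕ.≤-refl (inj₁ ℕ.≤-refl)

    isolate-split : ∀ k (k<r : k ℕ.< r) {s t} → s ℕ.≤ k → k ℕ.< t → t ℕ.≤ r → Ĝ (p s) (p t) ≡ true →
      (∀ {s′ t′} → s′ ℕ.≤ k → k ℕ.< t′ → t′ ℕ.≤ r → Ĝ (p s′) (p t′) ≡ true → (s ≡ s′ × t ≡ t′) ⊎ G (p s′) (p t′)) →
      G (p s) (p t)
    isolate-split k k<r s≤k k<t t≤r e good = isolate-merge Ĝ-sym pathBlock (splitBlocks k k<r)
      (whole∈A pathBlock onP)
      (cutAB (splitBlocks k k<r) k<r (λ t≤k → _ , z≤n , t≤k , refl) (λ k<t t≤r → _ , k<t , t≤r , refl))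
      seg-empty (seg-cases k k<r) (seg⊆OnP (ℕ.<⇒≤ k<r)) (seg⊆OnP ℕ.≤-refl)
      (_ , z≤n , s≤k , refl) (_ , k<t , t≤r , refl) e
      λ { (_ , _ , s′≤k , refl) (_ , k<t′ , t′≤r , refl) e′ → case good s′≤k k<t′ t′≤r e′ of λ
          { (inj₁ (refl , refl)) → inj₁ (refl , refl) ; (inj₂ g) → inj₂ g } }

    -- The one place where `q` generates. It arises from the path cut at its first edge by detaching
    -- `p 1`, and by chordlessness `p 1` has no other neighbour than `p 2` among the later nodes.
    good-second : G (p 1) (p 2)
    good-second = sym-G (isolate-drop Ĝ-sym X (isolating 0 2≤r)
      (cutBA X {0} 1≤r (λ { z≤n → 0 , z≤n , z≤n , refl }) (λ 0<t t≤r → _ , 0<t , t≤r , refl)) q∈S (p 1)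
      (1 , ℕ.≤-refl , 1≤r , refl) (λ s → ℕ.<⇒≱ ℕ.≤-refl (proj₁ (seg-index ℕ.≤-refl 1≤r s)))
      (λ { (t , 1≤t , t≤r , refl) → case ℕ.m≤n⇒m<n∨m≡n 1≤t of λ
           { (inj₁ 1<t) → inj₁ (t , 1<t , t≤r , refl) ; (inj₂ refl) → inj₂ refl } })
      (λ { (t , 1<t , t≤r , eq) → t , ℕ.<⇒≤ 1<t , t≤r , eq })
      (λ s → s) (λ s → s)
      (2 , ℕ.≤-refl , 2≤r , refl) (trans (Ĝ-sym _ _) (E⊆Ĝ (p-edge 2≤r)))
      λ { (t , 1<t , t≤r , refl) e → case no-chord 1<t t≤r (trans (Ĝ-sym _ _) e) of λ
          { (inj₁ refl) → inj₁ refl ; (inj₂ (() , _)) } })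
      where X = twoSegments 1 r 0 0 ℕ.≤-refl z≤n (inj₂ ℕ.≤-refl)

    -- The cut between `p 1` and `p 2` is crossed only by that path edge, already treated, and by
    -- the closing edge.
    good-close : G (p 0) (p r)
    good-close = isolate-split 1 2≤r z≤n 2≤r ℕ.≤-refl p-close λ s≤1 1<t t≤r e →
      case no-chord (ℕ.≤-<-trans s≤1 1<t) t≤r e of λ
        { (inj₁ refl) → inj₂ (subst (λ s → G (p s) (p (suc s))) (ℕ.≤-antisym (ℕ.s≤s⁻¹ 1<t) s≤1) good-second)
        ; (inj₂ (s≡0 , t≡r)) → inj₁ (sym s≡0 , sym t≡r) }

    good-edge : ∀ {k} → k ℕ.< r → G (p k) (p (suc k))
    good-edge {k} k<r = isolate-split k k<r ℕ.≤-refl ℕ.≤-refl k<r (E⊆Ĝ (p-edge k<r)) λ s≤k k<t t≤r e →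
      case no-chord (ℕ.≤-<-trans s≤k k<t) t≤r e of λ
        { (inj₁ refl) → case ℕ.≤-antisym s≤k (ℕ.s≤s⁻¹ k<t) of λ { refl → inj₁ (refl , refl) }
        ; (inj₂ (refl , refl)) → inj₂ good-close }

    good-path : ∀ {i j} → OnP i → OnP j → Ĝ i j ≡ true → G i j
    good-path (s , _ , s≤r , refl) (t , _ , t≤r , refl) e = case ℕ.<-cmp s t of λ
      { (tri< s<t _ _)  → increasing s<t t≤r e
      ; (tri≈ _ refl _) → contradiction (trans (sym e) (Ĝ-irrefl (p s))) λ ()
      ; (tri> _ _ t<s)  → sym-G (increasing t<s s≤r (trans (Ĝ-sym _ _) e)) }
      where
      increasing : ∀ {s t} → s ℕ.< t → t ℕ.≤ r → Ĝ (p s) (p t) ≡ true → G (p s) (p t)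
      increasing s<t t≤r e with no-chord s<t t≤r e
      ... | inj₁ refl          = good-edge t≤r
      ... | inj₂ (refl , refl) = good-close

    -- Detaching `u` from the tree path up to `z` cuts its edges to the nodes between as well; these
    -- are deeper than `z`, hence closer to `u`, and come by recursion.
    good-ancestor : ∀ {u z} → Anc u z → u ≢ z → Ĝ u z ≡ true → G u z
    good-ancestor {u} {z} a = go (dep u) (ℕ.m≤m+n (dep u) (dep z)) a
      where
      -- The number `m` bounds `dep u - dep z` without subtraction.
      go : ∀ m {z} → dep u ℕ.≤ m ℕ.+ dep z → Anc u z → u ≢ z → Ĝ u z ≡ true → G u z
      go m {z} u≤m+z (self _)     u≢z e = contradiction refl u≢z
      go m {z} u≤m+z (up ¬Pu a) u≢z e = sym-G (isolate-drop Ĝ-sym (ancestorInterval u z) (ancestorInterval (par u) z)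
        (whole∈B (ancestorInterval u z) onP) (whole∈B (ancestorInterval (par u) z) onP) u
        (self ¬Pu , up ¬Pu a) (λ { (b , _) → ¬anc-par ¬Pu b })
        (λ { (b , c) → case anc-split b of λ { (inj₁ b′) → inj₁ (b′ , c) ; (inj₂ x≡u) → inj₂ x≡u } })
        (λ { (b , c) → up ¬Pu b , c })
        (λ s → s) (λ s → s)
        (a , self (anc-off a)) (trans (Ĝ-sym _ _) e)
        λ { {y} (b , c) e′ → case anc-split c of λ
            { (inj₂ z≡y) → inj₁ z≡y
            ; (inj₁ c′) → inj₂ (sym-G (deeper m u≤m+z b (anc-par-dep (anc-off b) c′) (trans (Ĝ-sym _ _) e′))) } })
        where
        deeper : ∀ m → dep u ℕ.≤ m ℕ.+ dep z → ∀ {y} → Anc (par u) y → dep z ℕ.< dep y → Ĝ u y ≡ true → G u y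
        deeper zero u≤z b z<y e = contradiction (ℕ.<-trans z<y (anc-par-dep ¬Pu b)) (ℕ.≤⇒≯ u≤z)
        deeper (suc m) u≤ {y} b z<y e = go m
          (ℕ.≤-trans u≤ (ℕ.≤-trans (ℕ.≤-reflexive (sym (ℕ.+-suc m (dep z)))) (ℕ.+-monoʳ-≤ m z<y)))
          (up ¬Pu b) (λ { refl → ¬anc-par ¬Pu b }) e

    -- The branch of `u` ties it to its root, so `u` is separated from `p k` by cutting the path
    -- between `p k` and the root. This also cuts the edges from `u` to nodes farther out, which
    -- forces the order from the ends of the path inwards; the root comes last. Edges from proper
    -- ancestors are supplied by recursion on depth.
    good-to-path : ∀ {u} → ¬ OnP u → ∀ {k} → k ℕ.≤ r → Ĝ u (p k) ≡ true → G u (p k)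
    good-to-path {u} ¬Pu = go u (<-wellFounded (dep u)) ¬Pu
      where
      go : ∀ u → Acc ℕ._<_ (dep u) → ¬ OnP u → ∀ {k} → k ℕ.≤ r → Ĝ u (p k) ≡ true → G u (p k)
      go u (acc rs) ¬Pu {k} k≤r e = case ℕ.<-cmp k (rootIx u) of λ
        { (tri< k<ρ _ _)  → before (suc k) ℕ.≤-refl k<ρ e
        ; (tri> _ _ ρ<k)  → after r (ℕ.m≤m+n r k) k≤r ρ<k e
        ; (tri≈ _ k≡ρ _) → at k≡ρ }
        where

        W = wholePath u u
        W∈S = whole∈A W (inj₁ ∘ onP)

        proper : ∀ {y} → Anc (par u) y → ∀ {t} → t ℕ.≤ r → Ĝ y (p t) ≡ true → G y (p t)
        proper {y} a t≤r e = go y (rs (anc-par-dep ¬Pu a)) (anc-off a) t≤r e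

        -- The cut lies just before `p k`, so the branch stays with the earlier segment; `m` bounds
        -- `r - k`.
        after : ∀ m {k} → r ℕ.≤ m ℕ.+ k → k ℕ.≤ r → rootIx u ℕ.< k → Ĝ u (p k) ≡ true → G u (p k)
        after m {suc j} r≤m+k j<r (s≤s ρ≤j) e = isolate-merge Ĝ-sym W X W∈S
          (cutAB X j<r (λ t≤j → inj₁ (_ , z≤n , t≤j , refl)) (λ j<t t≤r → _ , j<t , t≤r , refl))
          seg-empty
          (λ { (inj₁ s) → case seg-cases j j<r s of λ { (inj₁ s′) → inj₁ (inj₁ s′) ; (inj₂ s′) → inj₂ s′ }
             ; (inj₂ a) → inj₁ (inj₂ a) })
          (λ { (inj₁ s) → inj₁ (seg⊆OnP (ℕ.<⇒≤ j<r) s) ; (inj₂ a) → inj₂ a })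
          (inj₁ ∘ seg⊆OnP ℕ.≤-refl)
          (inj₂ (inj₁ (self ¬Pu))) (suc j , ℕ.≤-refl , j<r , refl) e
          λ { (inj₁ s) s′ e′ → inj₂ (good-path (seg⊆OnP (ℕ.<⇒≤ j<r) s) (seg⊆OnP ℕ.≤-refl s′) e′)
            ; (inj₂ (inj₁ a)) s′ e′ → from-branch a s′ e′
            ; (inj₂ (inj₂ a)) s′ e′ → from-branch a s′ e′ }
          where
          X = branches 0 j u u (suc j) r (ℕ.<⇒≤ j<r) ℕ.≤-refl (inj₁ ℕ.≤-refl) (z≤n , ρ≤j) (z≤n , ρ≤j)
          further : ∀ m → r ℕ.≤ m ℕ.+ suc j → ∀ {t} → suc j ℕ.< t → t ℕ.≤ r → Ĝ u (p t) ≡ true → G u (p t)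
          further zero    r≤j j<t t≤r e = contradiction (ℕ.<-≤-trans j<t t≤r) (ℕ.≤⇒≯ r≤j)
          further (suc m) r≤  j<t t≤r e = after m
            (ℕ.≤-trans r≤ (ℕ.≤-trans (ℕ.≤-reflexive (sym (ℕ.+-suc m (suc j)))) (ℕ.+-monoʳ-≤ m j<t)))
            t≤r (ℕ.<-trans (s≤s ρ≤j) j<t) e
          from-branch : ∀ {x y} → Anc u x → Seg (suc j) r y → Ĝ x y ≡ true → (u ≡ x × p (suc j) ≡ y) ⊎ G x y
          from-branch a (t , j<t , t≤r , refl) e′ with anc-split a | ℕ.m≤n⇒m<n∨m≡n j<t
          ... | inj₁ a′   | _         = inj₂ (proper a′ t≤r e′)
          ... | inj₂ refl | inj₂ refl = inj₁ (refl , refl)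
          ... | inj₂ refl | inj₁ 1+j<t = inj₂ (further m r≤m+k 1+j<t t≤r e′)

        -- The mirror image: the cut lies just behind `p k`, and the branch belongs to the later
        -- segment.
        before : ∀ m {k} → k ℕ.< m → k ℕ.< rootIx u → Ĝ u (p k) ≡ true → G u (p k)
        before (suc m) {k} (s≤s k≤m) k<ρ e = isolate-merge Ĝ-sym W X W∈S
          (cutBA X k<r (λ t≤k → _ , z≤n , t≤k , refl) (λ k<t t≤r → inj₁ (_ , k<t , t≤r , refl)))
          seg-empty
          (λ { (inj₁ s) → case seg-cases k k<r s of λ { (inj₁ s′) → inj₂ s′ ; (inj₂ s′) → inj₁ (inj₁ s′) }
             ; (inj₂ a) → inj₁ (inj₂ a) })
          (λ { (inj₁ s) → inj₁ (seg⊆OnP ℕ.≤-refl s) ; (inj₂ a) → inj₂ a })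
          (inj₁ ∘ seg⊆OnP (ℕ.<⇒≤ k<r))
          (inj₂ (inj₁ (self ¬Pu))) (k , z≤n , ℕ.≤-refl , refl) e
          λ { (inj₁ s) s′ e′ → inj₂ (good-path (seg⊆OnP ℕ.≤-refl s) (seg⊆OnP (ℕ.<⇒≤ k<r) s′) e′)
            ; (inj₂ (inj₁ a)) s′ e′ → from-branch a s′ e′
            ; (inj₂ (inj₂ a)) s′ e′ → from-branch a s′ e′ }
          where
          k<r = ℕ.<-≤-trans k<ρ (rootIx≤r u)
          X = branches (suc k) r u u 0 k ℕ.≤-refl (ℕ.<⇒≤ k<r) (inj₂ ℕ.≤-refl) (k<ρ , rootIx≤r u) (k<ρ , rootIx≤r u)
          from-branch : ∀ {x y} → Anc u x → Seg 0 k y → Ĝ x y ≡ true → (u ≡ x × p k ≡ y) ⊎ G x y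
          from-branch a (t , _ , t≤k , refl) e′ with anc-split a | ℕ.m≤n⇒m<n∨m≡n t≤k
          ... | inj₁ a′   | _         = inj₂ (proper a′ (ℕ.≤-trans t≤k (ℕ.<⇒≤ k<r)) e′)
          ... | inj₂ refl | inj₂ refl = inj₁ (refl , refl)
          ... | inj₂ refl | inj₁ t<k  = inj₂ (before m (ℕ.<-≤-trans t<k k≤m) (ℕ.<-trans t<k k<ρ) e′)

        -- No cut of the path separates `u` from its own root, so `u` is detached as a leaf of its
        -- branch instead. All its other edges to the path and to its ancestors are known by now.
        at : k ≡ rootIx u → G u (p k)
        at k≡ρ = sym-G (isolate-drop Ĝ-sym W W′ W∈S (whole∈A W′ (inj₁ ∘ onP)) u
          (inj₂ (inj₁ (self ¬Pu)))
          (λ { (inj₁ s) → ¬Pu s ; (inj₂ (inj₁ a)) → ¬anc-par ¬Pu a ; (inj₂ (inj₂ a)) → ¬anc-par ¬Pu a })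
          (λ { (inj₁ s) → inj₁ (inj₁ s)
             ; (inj₂ (inj₁ a)) → case anc-split a of λ { (inj₁ a′) → inj₁ (inj₂ (inj₁ a′)) ; (inj₂ eq) → inj₂ eq }
             ; (inj₂ (inj₂ a)) → case anc-split a of λ { (inj₁ a′) → inj₁ (inj₂ (inj₂ a′)) ; (inj₂ eq) → inj₂ eq } })
          (λ { (inj₁ s) → inj₁ s ; (inj₂ (inj₁ a)) → inj₂ (inj₁ (up ¬Pu a)) ; (inj₂ (inj₂ a)) → inj₂ (inj₂ (up ¬Pu a)) })
          (λ s → s) (λ s → s)
          (inj₁ (onP k≤r)) (trans (Ĝ-sym _ _) e)
          λ { (inj₁ (t , _ , t≤r , refl)) e′ → on-path t≤r (trans (Ĝ-sym _ _) e′)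
            ; (inj₂ (inj₁ a)) e′ → inj₂ (above a (trans (Ĝ-sym _ _) e′))
            ; (inj₂ (inj₂ a)) e′ → inj₂ (above a (trans (Ĝ-sym _ _) e′)) })
          where
          W′ = wholePath (par u) (par u)
          above : ∀ {y} → Anc (par u) y → Ĝ u y ≡ true → G y u
          above a e′ = sym-G (good-ancestor (up ¬Pu a) (λ { refl → ¬anc-par ¬Pu a }) e′)
          on-path : ∀ {t} → t ℕ.≤ r → Ĝ u (p t) ≡ true → p k ≡ p t ⊎ G (p t) u
          on-path {t} t≤r e′ with ℕ.<-cmp t (rootIx u)
          ... | tri< t<ρ _ _ = inj₂ (sym-G (before (suc t) ℕ.≤-refl t<ρ e′))
          ... | tri> _ _ ρ<t = inj₂ (sym-G (after r (ℕ.m≤m+n r t) t≤r ρ<t e′))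
          ... | tri≈ _ t≡ρ _ = inj₁ (cong p (trans k≡ρ (sym t≡ρ)))

    -- Detaching `v` as the tip of its branch works unless the branch of `u` passes through `v`, and
    -- that case is `good-ancestor`. Otherwise the edges from `v` to proper ancestors of `u` come by
    -- recursion on the depth of `u`, with `v` fixed.
    good-off-path : ∀ {u v} → ¬ OnP u → ¬ OnP v → Ĝ u v ≡ true → G u v
    good-off-path {u} {v} ¬Pu ¬Pv = go u (<-wellFounded (dep u)) ¬Pu
      where
      go : ∀ u → Acc ℕ._<_ (dep u) → ¬ OnP u → Ĝ u v ≡ true → G u v
      go u (acc rs) ¬Pu e with Anc? u v
      ... | yes a = good-ancestor a (λ { refl → contradiction (trans (sym e) (Ĝ-irrefl u)) λ () }) e
      ... | no ¬a = isolate-drop Ĝ-sym W W′ (whole∈A W (inj₁ ∘ onP)) (whole∈A W′ (inj₁ ∘ onP)) v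
        (inj₂ (inj₂ (self ¬Pv)))
        (λ { (inj₁ s) → ¬Pv s ; (inj₂ (inj₁ a)) → ¬a a ; (inj₂ (inj₂ a)) → ¬anc-par ¬Pv a })
        (λ { (inj₁ s) → inj₁ (inj₁ s)
           ; (inj₂ (inj₁ a)) → inj₁ (inj₂ (inj₁ a))
           ; (inj₂ (inj₂ a)) → case anc-split a of λ { (inj₁ a′) → inj₁ (inj₂ (inj₂ a′)) ; (inj₂ eq) → inj₂ eq } })
        (λ { (inj₁ s) → inj₁ s ; (inj₂ (inj₁ a)) → inj₂ (inj₁ a) ; (inj₂ (inj₂ a)) → inj₂ (inj₂ (up ¬Pv a)) })
        (λ s → s) (λ s → s)
        (inj₂ (inj₁ (self ¬Pu))) e
        λ { (inj₁ (t , _ , t≤r , refl)) e′ → inj₂ (sym-G (good-to-path ¬Pv t≤r (trans (Ĝ-sym _ _) e′)))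
          ; {y} (inj₂ (inj₁ a)) e′ → case anc-split a of λ
              { (inj₁ a′) → inj₂ (go y (rs (anc-par-dep ¬Pu a′)) (anc-off a) e′) ; (inj₂ eq) → inj₁ (sym eq) }
          ; (inj₂ (inj₂ a)) e′ → inj₂ (sym-G
              (good-ancestor (up ¬Pv a) (λ { refl → ¬anc-par ¬Pv a }) (trans (Ĝ-sym _ _) e′))) }
        where
        W  = wholePath u v
        W′ = wholePath u (par v)

    good : ∀ i j → Ĝ i j ≡ true → G i j
    good i j e with Seg? 0 r i | Seg? 0 r j
    ... | yes Pi                    | yes Pj                    = good-path Pi Pj e
    ... | no ¬Pi                    | no ¬Pj                    = good-off-path ¬Pi ¬Pj e
    ... | no ¬Pi                    | yes (t , _ , t≤r , refl)  = good-to-path ¬Pi t≤r e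
    ... | yes (t , _ , t≤r , refl)  | no ¬Pj                    = sym-G (good-to-path ¬Pj t≤r (trans (Ĝ-sym _ _) e))

  noChord⇒facet : NoChord → {lhs rhs : Point n → ℚ} →
    (∀ ℓ → lhs (χ Ĝ ℓ) ≡ χ Ĝ ℓ (p 0) (p r)) → (∀ ℓ → rhs (χ Ĝ ℓ) ≡ len (χ Ĝ ℓ) r) → DefinesFacet E Ĝ lhs rhs
  noChord⇒facet no-chord {lhs} {rhs} lhs≡ rhs≡ = spanning⇒facet Ĝ Ĝ-sym E lhs rhs
    (λ ℓ _ → subst₂ _≤_ (sym (lhs≡ ℓ)) (sym (rhs≡ ℓ)) (valid ℓ))
    defect defect-linear (λ ℓ fℓ → x-x≡0 (face-tight {lhs} {rhs} lhs≡ rhs≡ {ℓ} (proj₂ fℓ)))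
    q (lab-decomposition (isolating 0 2≤r) E-sym) (defect-isolating 0 2≤r)
    (lab P) (whole P onP)
    (Spanning.good no-chord
      (λ X AX → inj₁ (whole X λ t≤r → AX t≤r))
      (λ X BX → inj₁ (face X (tight-whole (lab X) λ t≤r → lab-same X (inj₂ (inj₂ (BX t≤r , BX z≤n))))))
      (λ X j<r AX BX → inj₁ (face X (tight-cut (lab X) j<r
        (λ t≤j → lab-same X (inj₂ (inj₁ (AX t≤j , AX z≤n))))
        (λ j<t t≤r → lab-same X (inj₂ (inj₂ (BX j<t t≤r , BX j<r ℕ.≤-refl))))
        (separated X (AX z≤n) (BX j<r ℕ.≤-refl)))))
      (λ X j<r BX AX → inj₁ (face X (tight-cut (lab X) j<r
        (λ t≤j → lab-same X (inj₂ (inj₂ (BX t≤j , BX z≤n))))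
        (λ j<t t≤r → lab-same X (inj₂ (inj₁ (AX j<t t≤r , AX j<r ℕ.≤-refl))))
        (separated X (AX j<r ℕ.≤-refl) (BX z≤n) ∘ sym))))
      (inj₂ refl))
    where
    q = lab (isolating 0 2≤r)
    P = twoSegments 0 r (suc r) r ℕ.≤-refl ℕ.≤-refl (inj₁ ℕ.≤-refl)
    face : ∀ X → χ Ĝ (lab X) (p 0) (p r) ≡ len (χ Ĝ (lab X)) r →
      IsDecomposition E (lab X) × lhs (χ Ĝ (lab X)) ≡ rhs (χ Ĝ (lab X))
    face X tight = lab-decomposition X E-sym , trans (lhs≡ (lab X)) (trans tight (sym (rhs≡ (lab X))))
    whole : ∀ X → (∀ {t} → t ℕ.≤ r → A X (p t)) → IsDecomposition E (lab X) × lhs (χ Ĝ (lab X)) ≡ rhs (χ Ĝ (lab X))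
    whole X AX = face X (tight-whole (lab X) λ t≤r → lab-same X (inj₂ (inj₁ (AX t≤r , AX z≤n))))
    separated : ∀ X {x y} → A X x → B X y → lab X x ≢ lab X y
    separated X {x} {y} Ax By eq with lab-reflect X x y eq
    ... | inj₁ refl             = disjoint X Ax By
    ... | inj₂ (inj₁ (_ , Ay))  = disjoint X Ay By
    ... | inj₂ (inj₂ (Bx , _))  = disjoint X Ax Bx

-- Cyclic indices

psum-cong : ∀ {f g : ℕ → ℚ} k → (∀ {t} → t ℕ.< k → f t ≡ g t) → psum f k ≡ psum g k
psum-cong zero    f≗g = refl
psum-cong (suc k) f≗g = cong₂ _+_ (psum-cong k λ t<k → f≗g (ℕ.m<n⇒m<1+n t<k)) (f≗g ℕ.≤-refl)

psum-head : ∀ f k → psum f (suc k) ≡ f 0 + psum (f ∘ suc) k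
psum-head f zero    = ℚ.+-comm 0ℚ (f 0)
psum-head f (suc k) = trans (cong (_+ f (suc k)) (psum-head f k)) (ℚ.+-assoc (f 0) (psum (f ∘ suc) k) (f (suc k)))

∑-psum : ∀ k (h : ℕ → ℚ) → ∑ {k} (λ t → h (toℕ t)) ≡ psum h k
∑-psum zero    h = refl
∑-psum (suc k) h = trans (cong (h 0 +_) (∑-psum k (h ∘ suc))) (sym (psum-head h k))

-- A shift by one trades the first term `h′ 0` for the equal term `h′ M`.
psum-rotate : ∀ M h → (∀ t → h (t ℕ.+ M) ≡ h t) → ∀ a → psum (λ t → h (t ℕ.+ a)) M ≡ psum h M
psum-rotate M h periodic zero    = psum-cong M λ {t} _ → cong h (ℕ.+-identityʳ t)
psum-rotate M h periodic (suc a) = begin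
  psum (λ t → h (t ℕ.+ suc a)) M              ≡⟨ psum-cong M (λ {t} _ → cong h (ℕ.+-suc t a)) ⟩
  psum (h′ ∘ suc) M                           ≡⟨ solve 2 (λ x X → X := (x :+ X) :- x) refl (h′ 0) (psum (h′ ∘ suc) M) ⟩
  (h′ 0 + psum (h′ ∘ suc) M) - h′ 0           ≡⟨ cong (_- h′ 0) (sym (psum-head h′ M)) ⟩
  (psum h′ M + h′ M) - h′ 0                   ≡⟨ cong (λ z → (psum h′ M + z) - h′ 0) h′-periodic ⟩
  (psum h′ M + h′ 0) - h′ 0                   ≡⟨ solve 2 (λ x X → (X :+ x) :- x := X) refl (h′ 0) (psum h′ M) ⟩
  psum h′ M                                   ≡⟨ psum-rotate M h periodic a ⟩
  psum h M                                    ∎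
  where
  open ≡-Reasoning
  open +-*-Solver
  h′ = λ t → h (t ℕ.+ a)
  h′-periodic : h′ M ≡ h′ 0
  h′-periodic = trans (cong h (ℕ.+-comm M a)) (periodic a)

module _ {r : ℕ} where
  private M = suc r

  -- Reduction modulo the length of the cycle turns `cnext` into the successor on naturals and
  -- defines the path on all of them.
  ix : ℕ → Fin (suc r)
  ix t = fromℕ< (m%n<n t (suc r))

  toℕ-ix : ∀ t → toℕ (ix t) ≡ t % suc r
  toℕ-ix t = Fin.toℕ-fromℕ< (m%n<n t (suc r))

  ix-cong : ∀ {s t} → s % suc r ≡ t % suc r → ix s ≡ ix t
  ix-cong {s} {t} eq = Fin.toℕ-injective (trans (toℕ-ix s) (trans eq (sym (toℕ-ix t))))

  ix-unique : ∀ {t i} → toℕ i ≡ t → ix t ≡ i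
  ix-unique {i = i} refl = Fin.toℕ-injective (trans (toℕ-ix (toℕ i)) (m<n⇒m%n≡m (Fin.toℕ<n i)))

  ix-+M : ∀ t → ix (t ℕ.+ suc r) ≡ ix t
  ix-+M t = ix-cong {t ℕ.+ suc r} {t} ([m+n]%n≡m%n t (suc r))

  %-+-congˡ : ∀ {s t} z → s % suc r ≡ t % suc r → (s ℕ.+ z) % suc r ≡ (t ℕ.+ z) % suc r
  %-+-congˡ {s} {t} z eq = trans (%-distribˡ-+ s z M)
    (trans (cong (λ q → (q ℕ.+ z % M) % M) eq) (sym (%-distribˡ-+ t z M)))

  cnext-ix : ∀ t → cnext (ix t) ≡ ix (suc t)
  cnext-ix t = ix-cong {suc (toℕ (ix t))} {suc t} (begin
    suc (toℕ (ix t)) % M     ≡⟨ cong (λ q → suc q % M) (toℕ-ix t) ⟩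
    suc (t % M) % M          ≡⟨ cong (_% M) (ℕ.+-comm 1 (t % M)) ⟩
    (t % M ℕ.+ 1) % M        ≡⟨ %-+-congˡ {t % M} {t} 1 (m%n%n≡m%n t M) ⟩
    (t ℕ.+ 1) % M            ≡⟨ cong (_% M) (ℕ.+-comm t 1) ⟩
    suc t % M                ∎)
    where open ≡-Reasoning

  module _ {a : ℕ} (a≤M : a ℕ.≤ suc r) where

    private
      -- Adding `M ∸ a` undoes the shift by `a` modulo `M`, also when `a` equals `M`.
      unshift : ∀ t → (t ℕ.+ a ℕ.+ (M ℕ.∸ a)) % M ≡ t % M
      unshift t = trans (cong (_% M) (trans (ℕ.+-assoc t a (M ℕ.∸ a)) (cong (t ℕ.+_) (ℕ.m+[n∸m]≡n a≤M)))) ([m+n]%n≡m%n t M)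

    ix-shift-injective : ∀ {s t} → s ℕ.≤ r → t ℕ.≤ r → ix (s ℕ.+ a) ≡ ix (t ℕ.+ a) → s ≡ t
    ix-shift-injective {s} {t} s≤r t≤r eq = begin
      s                               ≡⟨ m<n⇒m%n≡m (s≤s s≤r) ⟨
      s % M                           ≡⟨ unshift s ⟨
      (s ℕ.+ a ℕ.+ (M ℕ.∸ a)) % M     ≡⟨ %-+-congˡ {s ℕ.+ a} {t ℕ.+ a} (M ℕ.∸ a) (trans (sym (toℕ-ix (s ℕ.+ a))) (trans (cong toℕ eq) (toℕ-ix (t ℕ.+ a)))) ⟩
      (t ℕ.+ a ℕ.+ (M ℕ.∸ a)) % M     ≡⟨ unshift t ⟩
      t % M                           ≡⟨ m<n⇒m%n≡m (s≤s t≤r) ⟩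
      t                               ∎
      where open ≡-Reasoning

    ix-shift-surjective : ∀ i → ∃ λ t → t ℕ.≤ r × ix (t ℕ.+ a) ≡ i
    ix-shift-surjective i = t , ℕ.s≤s⁻¹ (m%n<n s M) , trans (ix-cong {t ℕ.+ a} {toℕ i} (begin
      (s % M ℕ.+ a) % M                    ≡⟨ %-+-congˡ {s % M} {s} a (m%n%n≡m%n s M) ⟩
      (toℕ i ℕ.+ (M ℕ.∸ a) ℕ.+ a) % M      ≡⟨ cong (_% M) (trans (ℕ.+-assoc (toℕ i) (M ℕ.∸ a) a) (cong (toℕ i ℕ.+_) (ℕ.m∸n+n≡m a≤M))) ⟩
      (toℕ i ℕ.+ M) % M                    ≡⟨ [m+n]%n≡m%n (toℕ i) M ⟩
      toℕ i % M                            ∎)) (ix-unique refl)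
      where
      open ≡-Reasoning
      s = toℕ i ℕ.+ (M ℕ.∸ a)
      t = s % M

ix-last : ∀ {r} (f : Fin (suc r)) → ix (r ℕ.+ suc (toℕ f)) ≡ f
ix-last {r} f = trans (cong ix (trans (ℕ.+-suc r (toℕ f)) (ℕ.+-comm (suc r) (toℕ f)))) (trans (ix-+M (toℕ f)) (ix-unique refl))

-- Reduction of cycles and lifted paths to closed paths

module _ {n : ℕ} {E Ĝ : Graph n} (C : ClosedPath E Ĝ) (conn : Connected E) where
  open ClosedPath C

  -- The offset `a` serves both kinds of inequality: it is 0 for a path, and for a cycle it makes
  -- the path begin behind the edge `f`. The two sides are compared only on characteristic vectors,
  -- where an edge may be read in either orientation.
  facet⇔chordless : (c : Fin (suc r) → Fin n) {a : ℕ} → a ℕ.≤ suc r → (∀ t → p t ≡ c (ix (t ℕ.+ a))) →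
    (lhs rhs : Point n → ℚ) →
    (∀ ℓ → lhs (χ Ĝ ℓ) ≡ χ Ĝ ℓ (p 0) (p r)) → (∀ ℓ → rhs (χ Ĝ ℓ) ≡ len (χ Ĝ ℓ) r) →
    DefinesFacet E Ĝ lhs rhs ⇔ Chordless Ĝ c
  facet⇔chordless c {a} a≤M p≡ lhs rhs lhs≡ rhs≡ = mk⇔ to from
    where
    from : Chordless Ĝ c → DefinesFacet E Ĝ lhs rhs
    from chordless = noChord⇒facet C conn no-chord {lhs} {rhs} lhs≡ rhs≡
      where
      no-chord : NoChord
      no-chord {s} {t} s<t t≤r e with t ℕ.≟ suc s | (s ℕ.≟ 0) ×-dec (t ℕ.≟ r)
      ... | yes t≡1+s | _           = inj₁ t≡1+s
      ... | no _      | yes closing = inj₂ closing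
      ... | no t≢1+s  | no ¬closing = contradiction
        (trans (sym e) (trans (cong₂ Ĝ (p≡ s) (p≡ t)) (chordless (ix (s ℕ.+ a)) (ix (t ℕ.+ a)) i≢j j≢next i≢next))) λ ()
        where
        s≤r = ℕ.≤-trans (ℕ.<⇒≤ s<t) t≤r
        i≢j : ix (s ℕ.+ a) ≢ ix (t ℕ.+ a)
        i≢j eq = ℕ.<⇒≢ s<t (ix-shift-injective a≤M s≤r t≤r eq)
        j≢next : ix (t ℕ.+ a) ≢ cnext (ix (s ℕ.+ a))
        j≢next eq = t≢1+s (ix-shift-injective a≤M t≤r (ℕ.≤-trans s<t t≤r) (trans eq (cnext-ix (s ℕ.+ a))))
        i≢next : ix (s ℕ.+ a) ≢ cnext (ix (t ℕ.+ a))
        i≢next eq with ℕ.m≤n⇒m<n∨m≡n t≤r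
        ... | inj₁ t<r  = ℕ.<⇒≢ (ℕ.m<n⇒m<1+n s<t)
          (ix-shift-injective a≤M s≤r t<r (trans eq (cnext-ix (t ℕ.+ a))))
        -- From the last index the successor wraps around to `p 0`, which is the closing pair.
        ... | inj₂ refl = ¬closing (ix-shift-injective a≤M s≤r z≤n
          (trans eq (trans (cnext-ix (r ℕ.+ a)) (trans (cong ix (ℕ.+-comm (suc r) a)) (ix-+M a)))) , refl)
    to : DefinesFacet E Ĝ lhs rhs → Chordless Ĝ c
    to facet i j i≢j j≢next i≢next = Bool.¬-not no-edge
      where
      chord : ∀ {s t} → s ℕ.< t → t ℕ.≤ r → ix (t ℕ.+ a) ≢ cnext (ix (s ℕ.+ a)) →
        ix (s ℕ.+ a) ≢ cnext (ix (t ℕ.+ a)) → Ĝ (c (ix (s ℕ.+ a))) (c (ix (t ℕ.+ a))) ≢ true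
      chord {s} {t} s<t t≤r j≢next i≢next e = chord⇒¬facet {lhs} {rhs} lhs≡ rhs≡ s<t t≤r
        (trans (cong₂ Ĝ (p≡ s) (p≡ t)) e)
        (λ { refl → j≢next (sym (cnext-ix (s ℕ.+ a))) })
        (λ { (refl , refl) → i≢next (sym (trans (cnext-ix (r ℕ.+ a)) (trans (cong ix (ℕ.+-comm (suc r) a)) (ix-+M a)))) })
        facet
      no-edge : Ĝ (c i) (c j) ≢ true
      no-edge e with ix-shift-surjective a≤M i | ix-shift-surjective a≤M j
      ... | s , s≤r , refl | t , t≤r , refl with ℕ.<-cmp s t
      ...   | tri< s<t _ _  = chord s<t t≤r j≢next i≢next e
      ...   | tri≈ _ refl _ = i≢j refl
      ...   | tri> _ _ t<s  = chord t<s s≤r i≢next j≢next (trans (Ĝ-sym _ _) e)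

∪-sym : ∀ {n} {E F : Graph n} → SimpleGraph E → SimpleGraph F → ∀ i j → (E ∪G F) i j ≡ (E ∪G F) j i
∪-sym (E-sym , _) (F-sym , _) i j = cong₂ _∨_ (E-sym i j) (F-sym i j)

∪-irrefl : ∀ {n} {E F : Graph n} → SimpleGraph E → SimpleGraph F → ∀ i → (E ∪G F) i i ≡ false
∪-irrefl (_ , E-irr) (_ , F-irr) i = cong₂ _∨_ (E-irr i) (F-irr i)

⊆-∪ˡ : ∀ {n} {E F : Graph n} {i j} → E i j ≡ true → (E ∪G F) i j ≡ true
⊆-∪ˡ {F = F} {i} {j} e = cong (_∨ F i j) e

⊆-∪ʳ : ∀ {n} {E F : Graph n} {i j} → F i j ≡ true → (E ∪G F) i j ≡ true
⊆-∪ʳ {E = E} {i = i} {j} e = trans (cong (E i j ∨_) e) (Bool.∨-zeroʳ (E i j))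

-- The path starts at the head of the edge f and ends at its tail.
cyclePath : ∀ {n r} {E F : Graph n} → SimpleGraph E → SimpleGraph F → {c : Fin (suc r) → Fin n} →
  IsCycle E c → Fin (suc r) → ClosedPath E (E ∪G F)
cyclePath {r = r} {E} {F} sE sF {c} (3≤m , inj , edge) f = record
  { E-sym = proj₁ sE ; Ĝ-sym = ∪-sym {E = E} {F} sE sF ; Ĝ-irrefl = ∪-irrefl {E = E} {F} sE sF ; E⊆Ĝ = ⊆-∪ˡ {E = E} {F}
  ; r = r ; 2≤r = ℕ.s≤s⁻¹ 3≤m ; p = λ t → c (ix (t ℕ.+ suc (toℕ f)))
  ; p-inj = λ s≤r t≤r eq → ix-shift-injective (Fin.toℕ<n f) s≤r t≤r (inj _ _ eq)
  ; p-edge = λ {t} _ → subst (λ k → E (c (ix (t ℕ.+ suc (toℕ f)))) (c k) ≡ true)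
      (cnext-ix (t ℕ.+ suc (toℕ f))) (edge (ix (t ℕ.+ suc (toℕ f))))
  ; p-close = trans (∪-sym {E = E} {F} sE sF _ _) (subst (λ k → (E ∪G F) (c k) (c (cnext f)) ≡ true)
      (sym (ix-last f)) (⊆-∪ˡ {E = E} {F} (edge f))) }

-- Rotated to start behind `f`, the sum has `f` at its last index `r`, where the summand is 0.
cycSumExcept-psum : ∀ {n r} (c : Fin (suc r) → Fin n) f (x : Point n) →
  let p = λ t → c (ix (t ℕ.+ suc (toℕ f))) in cycSumExcept c f x ≡ psum (λ t → x (p t) (p (suc t))) r
cycSumExcept-psum {n} {r} c f x = begin
  ∑ g                                             ≡⟨ ∑-cong {suc r} (λ k → cong g (sym (ix-unique {i = k} refl))) ⟩
  ∑ {suc r} (λ k → g (ix (toℕ k)))                ≡⟨ ∑-psum (suc r) (g ∘ ix) ⟩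
  psum (g ∘ ix) (suc r)                           ≡⟨ psum-rotate (suc r) (g ∘ ix) (λ t → cong g (ix-+M t)) a ⟨
  psum (λ t → g (ix (t ℕ.+ a))) r + g (ix (r ℕ.+ a)) ≡⟨ cong₂ _+_ (psum-cong r λ {t} t<r → g-off t<r) (trans (cong g (ix-last f)) g-f) ⟩
  psum (λ t → x (p t) (p (suc t))) r + 0ℚ         ≡⟨ ℚ.+-identityʳ _ ⟩
  psum (λ t → x (p t) (p (suc t))) r              ∎
  where
  open ≡-Reasoning
  a = suc (toℕ f)
  p = λ t → c (ix (t ℕ.+ a))
  g : Fin (suc r) → ℚ
  g k = if ⌊ k ≟ f ⌋ then 0ℚ else x (c k) (c (cnext k))
  g-f : g f ≡ 0ℚ
  g-f with f ≟ f
  ... | yes _ = refl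
  ... | no ne = contradiction refl ne
  g-≢ : ∀ {k} → k ≢ f → g k ≡ x (c k) (c (cnext k))
  g-≢ {k} k≢f with k ≟ f
  ... | yes eq = contradiction eq k≢f
  ... | no _   = refl
  g-off : ∀ {t} → t ℕ.< r → g (ix (t ℕ.+ a)) ≡ x (p t) (p (suc t))
  g-off {t} t<r = trans
    (g-≢ λ eq → ℕ.<⇒≢ t<r (ix-shift-injective (Fin.toℕ<n f) (ℕ.<⇒≤ t<r) ℕ.≤-refl (trans eq (sym (ix-last f)))))
    (cong (λ k → x (p t) (c k)) (cnext-ix (t ℕ.+ a)))

module _ {n m : ℕ} {E F : Graph n} (sE : SimpleGraph E) (sF : SimpleGraph F) (disj : Disjoint E F)
  {u v : Fin n} (uv∈F : F u v ≡ true) {w : Fin (suc m) → Fin n} (path : IsPath E u v w) where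

  private
    p : ℕ → Fin n
    p t = w (ix (t ℕ.+ 0))
    w-inj = proj₁ path
    p₀≡u : p 0 ≡ u
    p₀≡u = trans (cong w (ix-unique refl)) (proj₁ (proj₂ path))
    pₘ≡v : p m ≡ v
    pₘ≡v = trans (cong w (ix-unique (trans (Fin.toℕ-fromℕ m) (sym (ℕ.+-identityʳ m))))) (proj₁ (proj₂ (proj₂ path)))
    p-inject₁ : ∀ k → p (toℕ k) ≡ w (inject₁ k)
    p-inject₁ k = cong w (ix-unique (trans (Fin.toℕ-inject₁ k) (sym (ℕ.+-identityʳ (toℕ k)))))
    p-suc : ∀ (k : Fin m) → p (suc (toℕ k)) ≡ w (suc k)
    p-suc k = cong w (ix-unique (cong suc (sym (ℕ.+-identityʳ (toℕ k)))))
    edge : ∀ {t} → t ℕ.< m → E (p t) (p (suc t)) ≡ true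
    edge {t} t<m = subst (λ t → E (p t) (p (suc t)) ≡ true) (Fin.toℕ-fromℕ< t<m)
      (trans (cong₂ E (p-inject₁ k) (p-suc k)) (proj₂ (proj₂ (proj₂ path)) k))
      where k = fromℕ< t<m
    close : (E ∪G F) (p 0) (p m) ≡ true
    close = trans (cong₂ (E ∪G F) p₀≡u pₘ≡v) (⊆-∪ʳ {E = E} {F} uv∈F)
    -- With `m = 0` the edge `uv` would be a loop of `F`, and with `m = 1` it would lie in `E` too.
    -- The auxiliary `k` allows matching on the length.
    2≤m : ∀ k → k ≡ m → 2 ℕ.≤ m
    2≤m zero          refl = contradiction (trans (sym uv∈F) (trans (cong₂ F (sym p₀≡u) (sym pₘ≡v)) (proj₂ sF (p 0)))) λ ()
    2≤m (suc zero)    refl = contradiction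
      (trans (sym uv∈F) (trans (cong₂ F (sym p₀≡u) (sym pₘ≡v)) (disj (p 0) (p 1) (edge ℕ.≤-refl)))) λ ()
    2≤m (suc (suc k)) refl = s≤s (s≤s z≤n)

  liftedPath : ClosedPath E (E ∪G F)
  liftedPath = record
    { E-sym = proj₁ sE ; Ĝ-sym = ∪-sym {E = E} {F} sE sF ; Ĝ-irrefl = ∪-irrefl {E = E} {F} sE sF ; E⊆Ĝ = ⊆-∪ˡ {E = E} {F}
    ; r = m ; 2≤r = 2≤m m refl ; p = p
    ; p-inj = λ s≤m t≤m eq → ix-shift-injective z≤n s≤m t≤m (w-inj _ _ eq)
    ; p-edge = edge ; p-close = close }

  pathSum-psum : ∀ (x : Point n) → pathSum w x ≡ psum (λ t → x (p t) (p (suc t))) m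
  pathSum-psum x = trans (∑-cong {m} λ k → sym (cong₂ x (p-inject₁ k) (p-suc k))) (∑-psum m λ t → x (p t) (p (suc t)))

  closed-cycle : IsCycle (E ∪G F) w
  closed-cycle = s≤s (2≤m m refl) , w-inj , λ k → case ix-shift-surjective {m} {0} z≤n k of λ
    { (t , t≤m , refl) → subst (λ k → (E ∪G F) (p t) (w k) ≡ true) (sym (cnext-ix (t ℕ.+ 0))) (next t≤m) }
    where
    next : ∀ {t} → t ℕ.≤ m → (E ∪G F) (p t) (p (suc t)) ≡ true
    next t≤m with ℕ.m≤n⇒m<n∨m≡n t≤m
    ... | inj₁ t<m  = ⊆-∪ˡ {E = E} {F} (edge t<m)
    -- The index `suc m` wraps around to 0, so this last edge of the cycle is `uv` itself, traversed
    -- backwards.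
    ... | inj₂ refl = trans (cong (λ k → (E ∪G F) (p m) (w k)) (trans (cong ix (ℕ.+-identityʳ (suc m))) (ix-+M 0)))
      (trans (∪-sym {E = E} {F} sE sF _ _) close)

  lifted-facet : Connected E →
    DefinesFacet E (E ∪G F) (λ x → x u v) (pathSum w) ⇔ (IsCycle (E ∪G F) w × Chordless (E ∪G F) w)
  lifted-facet conn = mk⇔ (λ facet → closed-cycle , Equivalence.to core facet) (Equivalence.from core ∘ proj₂)
    where
    core : DefinesFacet E (E ∪G F) (λ x → x u v) (pathSum w) ⇔ Chordless (E ∪G F) w
    core = facet⇔chordless liftedPath conn w z≤n (λ _ → refl) (λ x → x u v) (pathSum w)
      (λ ℓ → cong₂ (χ (E ∪G F) ℓ) (sym p₀≡u) (sym pₘ≡v)) (λ ℓ → pathSum-psum (χ (E ∪G F) ℓ))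

theorem5p8 : (n : ℕ) (E F : Graph n) → SimpleGraph E → SimpleGraph F →
    Disjoint E F → Connected E →
    ((m : ℕ) (c : Fin m → Fin n) (f : Fin m) → IsCycle E c →
    (DefinesFacet E (E ∪G F) (λ x → x (c f) (c (cnext f))) (cycSumExcept c f)
    ⇔ Chordless (E ∪G F) c))
    ×
    ((u v : Fin n) → F u v ≡ true → (m : ℕ) (w : Fin (suc m) → Fin n) →
    IsPath E u v w →
    (DefinesFacet E (E ∪G F) (λ x → x u v) (pathSum w)
    ⇔ (IsCycle (E ∪G F) w × Chordless (E ∪G F) w)))
theorem5p8 n E F sE sF disj conn =
  (λ { zero c () ; (suc r) c f cyc → facet⇔chordless (cyclePath {F = F} sE sF cyc f) conn c (Fin.toℕ<n f) (λ _ → refl)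
        (λ x → x (c f) (c (cnext f))) (cycSumExcept c f)
        -- The path begins at the head of `f`, so the left side of the inequality reads the closing
        -- edge from `p r` to `p 0`.
        (λ ℓ → trans (χ-sym (E ∪G F) (∪-sym {E = E} {F} sE sF) ℓ (c f) (c (cnext f)))
          (cong (λ k → χ (E ∪G F) ℓ (c (cnext f)) (c k)) (sym (ix-last f))))
        (λ ℓ → cycSumExcept-psum c f (χ (E ∪G F) ℓ)) }) ,
  λ u v uv∈F m w path → lifted-facet sE sF disj uv∈F path conn
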